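{- For any computable, nondecreasing, unbounded function $f:\omega\to\omega$ there is an $f$-c.e. set $B$ that has an asymptotic density, but such that for every $n \in \omega$ the real $\rho(B)$ is not the asymptotic density of any $n$-c.e. set.
   Context: For $X \subseteq \omega=\{0,1,2,\dots\}$ and an integer $m>0$, let $\rho_m(X) = |\{j \in X : j < m\}|/m$. The set $X$ has a (asymptotic) density if $\lim_m \rho_m(X)$ exists, and the density is then $\rho(X) = \lim_m \rho_m(X)$. Sets are identified with their characteristic functions. For a function $f:\omega\to\omega$, a set $A \subseteq \omega$ is $f$-c.e. if there is a computable function $g:\omega\times\omega\to\{0,1\}$ such that for all $x$: $g(x,0)=0$, $A(x)=\lim_s g(x,s)$, and $|\{s : g(x,s) \neq g(x,s+1)\}| \leq f(x)$. For $n\in\omega$, a set is $n$-c.e. if it is $c_n$-c.e., where $c_n$ is the constant function with value $n$. -}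

module Defs where

open import Data.Bool.Base using (Bool; true; false; _xor_; if_then_else_)
open import Data.Fin.Base using (Fin)
open import Data.Integer.Base using (+_)
open import Data.List.Base using (length; filterᵇ; upTo)
open import Data.Nat.Base using (ℕ; zero; suc; _≤_; _<_; NonZero)
open import Data.Product.Base using (∃-syntax; _×_)
open import Data.Rational.Unnormalised.Base as ℚ using (ℚᵘ; 0ℚᵘ; _/_; _-_; ∣_∣)
open import Data.Vec.Base using (Vec; []; _∷_; lookup)
open import Function.Base using (const)
open import Relation.Binary.PropositionalEquality.Core using (_≡_)

------------------------------------------------------------------------
-- Computable functions: Kleene's μ-recursive functions

data Code : ℕ → Set where
  zer  : ∀ {n} → Code n
  succ : Code 1
  proj : ∀ {n} → Fin n → Code n
  comp : ∀ {m n} → Code m → Vec (Code n) m → Code n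
  prec : ∀ {n} → Code n → Code (suc (suc n)) → Code (suc n)
  mu   : ∀ {n} → Code (suc n) → Code n

infix 4 _[_]↦_

-- c [ xs ]↦ y : the partial function coded by c is defined at xs, with value y.
data _[_]↦_ : ∀ {n} → Code n → Vec ℕ n → ℕ → Set where
  zer↦  : ∀ {n} {xs : Vec ℕ n} → zer [ xs ]↦ 0
  succ↦ : ∀ {x} → succ [ x ∷ [] ]↦ suc x
  proj↦ : ∀ {n} {xs : Vec ℕ n} (i : Fin n) → proj i [ xs ]↦ lookup xs i
  comp↦ : ∀ {m n} {c : Code m} {ds : Vec (Code n) m} {xs : Vec ℕ n} {z : ℕ}
          (ys : Vec ℕ m) →
          (∀ i → lookup ds i [ xs ]↦ lookup ys i) →
          c [ ys ]↦ z →
          comp c ds [ xs ]↦ z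
  prec↦zero : ∀ {n} {c : Code n} {d : Code (suc (suc n))} {xs : Vec ℕ n} {y : ℕ} →
          c [ xs ]↦ y →
          prec c d [ 0 ∷ xs ]↦ y
  prec↦suc : ∀ {n} {c : Code n} {d : Code (suc (suc n))} {xs : Vec ℕ n} {k y z : ℕ} →
          prec c d [ k ∷ xs ]↦ y →
          d [ k ∷ y ∷ xs ]↦ z →
          prec c d [ suc k ∷ xs ]↦ z
  mu↦   : ∀ {n} {c : Code (suc n)} {xs : Vec ℕ n} {y : ℕ} →
          c [ y ∷ xs ]↦ 0 →
          (∀ z → z < y → ∃[ k ] c [ z ∷ xs ]↦ suc k) →
          mu c [ xs ]↦ y

Computable : (ℕ → ℕ) → Set
Computable f = ∃[ c ] (∀ x → c [ x ∷ [] ]↦ f x)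

Computable₂ : (ℕ → ℕ → Bool) → Set
Computable₂ g = ∃[ c ] (∀ x s → c [ x ∷ s ∷ [] ]↦ (if g x s then 1 else 0))

Unbounded : (ℕ → ℕ) → Set
Unbounded f = ∀ k → ∃[ x ] k < f x

------------------------------------------------------------------------
-- Sets of natural numbers, identified with their characteristic functions

SetOfℕ : Set
SetOfℕ = ℕ → Bool

count : SetOfℕ → ℕ → ℕ
count X m = length (filterᵇ X (upTo m))

-- |X| ≤ k, for a possibly infinite X: this holds iff every initial
-- segment of X has at most k elements.
AtMost : ℕ → SetOfℕ → Set
AtMost k X = ∀ m → count X m ≤ k

changes : (ℕ → ℕ → Bool) → ℕ → SetOfℕ
changes g x s = g x s xor g x (suc s)

FCE : (ℕ → ℕ) → SetOfℕ → Set
FCE f A = ∃[ g ] Computable₂ g × (∀ x →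
    g x 0 ≡ false
  × (∃[ s ] ∀ t → s ≤ t → g x t ≡ A x)
  × AtMost (f x) (changes g x))

NCE : ℕ → SetOfℕ → Set
NCE n = FCE (const n)

------------------------------------------------------------------------
-- Real numbers, as Cauchy sequences of rationals

record ℝ : Set where
  field
    seq    : ℕ → ℚᵘ
    cauchy : ∀ ε → 0ℚᵘ ℚ.< ε →
             ∃[ N ] ∀ i j → N ≤ i → N ≤ j → ∣ seq i - seq j ∣ ℚ.< ε

-- |q - r| < ε.  The gap between δ and ε makes the inequality strict in
-- the limit.
Within : ℚᵘ → ℚᵘ → ℝ → Set
Within ε q r = ∃[ δ ] δ ℚ.< ε × (∃[ K ] ∀ k → K ≤ k → ∣ q - ℝ.seq r k ∣ ℚ.≤ δ)

------------------------------------------------------------------------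
-- Asymptotic density

ρ : SetOfℕ → (m : ℕ) .{{_ : NonZero m}} → ℚᵘ
ρ X m = + count X m / m

HasDensity : SetOfℕ → ℝ → Set
HasDensity X r = ∀ ε → 0ℚᵘ ℚ.< ε →
  ∃[ N ] ∀ m → .{{_ : NonZero m}} → N ≤ m → Within ε (ρ X m) r

{-# OPTIONS --safe #-}

-- Let C be n-c.e., with U(m) and D(m) the numbers of changes 0 → 1 and 1 → 0 that its
-- approximation makes on the x < m.  Then |C ∩ m| = U(m) - D(m), so if C has a density, it is
-- limsup U(m)/m - limsup D(m)/m.  For fixed k, sup_{m > k} U(m)/m is approximated from below,
-- hence its value at a given precision is reached after boundedly many changes, and it agrees
-- with the limsup at this precision once k is large; likewise for D.
--
-- B is put together from the columns { 4^e (2q+1) : q ∈ ω }, of density 1/(2 * 4^e).  On column e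
-- the approximation of B at x is one bit computed from the suprema with k = x, for the program
-- coded by e.  At a precision of 1/(16 * 4^e), this takes a number of changes depending on e only,
-- so it is within f(x) for almost all x, and the smaller x are left out of B.  As the bits
-- stabilise to some b_e on column e, ρ(B) is the sum of b_e / (2 * 4^e); b_e is chosen to be 1 just
-- if the fractional part of 4^e times the density of the e-th set appears to be below 1/2.  Since
-- the tail of the sum beyond e is at most 1/6 after multiplication by 4^e, the two densities differ.
module Submission where

open import Defs
open import Axiom.ExcludedMiddle using (ExcludedMiddle)
open import Data.Bool.Base using (Bool; true; false; T; _∧_; _∨_; _xor_; if_then_else_)
open import Data.Bool.Properties using (xor-same)
open import Data.Empty using (⊥; ⊥-elim)
open import Data.Fin.Base using (Fin; zero; suc)
open import Data.Integer.Base as ℤ using (-[1+_]; +[1+_]; +<+; +≤+; -≤+)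
import Data.Integer.Properties as ℤ
open import Data.List.Base using ([]; _∷_; _++_; length; filterᵇ; upTo)
open import Data.List.Properties using (length-++; filter-++; upTo-∷ʳ)
open import Data.Nat.Base
open import Data.Nat.DivMod using (m≡m%n+[m/n]*n; m%n<n; m/n*n≤m)
open import Data.Nat.Properties
open import Data.Nat.Tactic.RingSolver using (solve-∀)
open import Data.Product.Base
open import Data.Rational.Unnormalised.Base as ℚ using (ℚᵘ; mkℚᵘ; 0ℚᵘ; *≤*; *<*; *≡*)
import Data.Rational.Unnormalised.Properties as ℚ
open import Data.Sum.Base using (_⊎_; inj₁; inj₂)
open import Data.Unit.Base using (⊤; tt)
open import Data.Vec.Base using (Vec; []; _∷_; lookup; tabulate)
open import Data.Vec.Properties using (lookup∘tabulate)
open import Function.Base using (_∘_; _$_; const)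
open import Level using (0ℓ)
open import Relation.Binary.Definitions using (Monotonic₁)
open import Relation.Binary.PropositionalEquality
open import Relation.Nullary.Decidable.Core using (Dec; yes; no; T?)
open import Relation.Nullary.Negation.Core using (¬_; contradiction)

-- Recursive functions and their closure properties.

-- Environments are nested pairs rather than vectors so that, thanks to eta, the
-- bodies of binders below are found by unification.
Env : ℕ → Set
Env zero    = ⊤
Env (suc n) = ℕ × Env n

toVec : ∀ {n} → Env n → Vec ℕ n
toVec {zero}  _        = []
toVec {suc n} (x , xs) = x ∷ toVec xs

Rec : ∀ {n} → (Env n → ℕ) → Set
Rec {n} f = Σ[ c ∈ Code n ] (∀ xs → c [ toVec xs ]↦ f xs)

Rec₁ : (ℕ → ℕ) → Set
Rec₁ f = Rec {1} (λ (a , _) → f a)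

Rec₂ : (ℕ → ℕ → ℕ) → Set
Rec₂ f = Rec {2} (λ (a , b , _) → f a b)

Rec₃ : (ℕ → ℕ → ℕ → ℕ) → Set
Rec₃ f = Rec {3} (λ (a , b , c , _) → f a b c)

Rec₄ : (ℕ → ℕ → ℕ → ℕ → ℕ) → Set
Rec₄ f = Rec {4} (λ (a , b , c , d , _) → f a b c d)

χ : Bool → ℕ
χ b = if b then 1 else 0

RecB : ∀ {n} → (Env n → Bool) → Set
RecB p = Rec (λ xs → χ (p xs))

Rec-cong : ∀ {n} {f g : Env n → ℕ} → (∀ xs → f xs ≡ g xs) → Rec f → Rec g
Rec-cong eq (c , h) = c , λ xs → subst (c [ toVec xs ]↦_) (eq xs) (h xs)

compR : ∀ {m n} {h : Env m → ℕ} → Rec h → (fs : Env n → Env m) →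
        (∀ i → Rec (λ xs → lookup (toVec (fs xs)) i)) → Rec (λ xs → h (fs xs))
compR (c , hc) fs rs =
  comp c (tabulate (λ i → proj₁ (rs i))) ,
  λ xs → comp↦ (toVec (fs xs))
    (λ i → subst (_[ toVec xs ]↦ lookup (toVec (fs xs)) i)
             (sym (lookup∘tabulate (λ j → proj₁ (rs j)) i)) (proj₂ (rs i) xs))
    (hc (fs xs))

module _ {n : ℕ} where

  app₁ : ∀ {h} {f : Env n → ℕ} → Rec₁ h → Rec f → Rec (λ xs → h (f xs))
  app₁ {f = f} H F = compR H (λ xs → f xs , tt) λ { zero → F }

  app₂ : ∀ {h} {f g : Env n → ℕ} → Rec₂ h → Rec f → Rec g → Rec (λ xs → h (f xs) (g xs))
  app₂ {f = f} {g} H F G = compR H (λ xs → f xs , g xs , tt) λ { zero → F ; (suc zero) → G }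

  app₃ : ∀ {h} {f g k : Env n → ℕ} → Rec₃ h → Rec f → Rec g → Rec k →
         Rec (λ xs → h (f xs) (g xs) (k xs))
  app₃ {f = f} {g} {k} H F G K = compR H (λ xs → f xs , g xs , k xs , tt)
    λ { zero → F ; (suc zero) → G ; (suc (suc zero)) → K }

  app₄ : ∀ {h} {f g k l : Env n → ℕ} → Rec₄ h → Rec f → Rec g → Rec k → Rec l →
         Rec (λ xs → h (f xs) (g xs) (k xs) (l xs))
  app₄ {f = f} {g} {k} {l} H F G K L = compR H (λ xs → f xs , g xs , k xs , l xs , tt)
    λ { zero → F ; (suc zero) → G ; (suc (suc zero)) → K ; (suc (suc (suc zero))) → L }

lookupR : ∀ {n} (i : Fin n) → Rec (λ xs → lookup (toVec xs) i)
lookupR i = proj i , λ xs → proj↦ i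

v0 : ∀ {n} → Rec {suc n} proj₁
v0 = lookupR zero
v1 : ∀ {n} → Rec {suc (suc n)} (λ xs → proj₁ (proj₂ xs))
v1 = lookupR (suc zero)
v2 : ∀ {n} → Rec {suc (suc (suc n))} (λ xs → proj₁ (proj₂ (proj₂ xs)))
v2 = lookupR (suc (suc zero))
v3 : ∀ {n} → Rec {suc (suc (suc (suc n)))} (λ xs → proj₁ (proj₂ (proj₂ (proj₂ xs))))
v3 = lookupR (suc (suc (suc zero)))
v4 : ∀ {n} → Rec {suc (suc (suc (suc (suc n))))} (λ xs → proj₁ (proj₂ (proj₂ (proj₂ (proj₂ xs)))))
v4 = lookupR (suc (suc (suc (suc zero))))

sucR : ∀ {n} {f : Env n → ℕ} → Rec f → Rec (λ xs → suc (f xs))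
sucR = app₁ (succ , λ _ → succ↦)

litR : ∀ {n} k → Rec {n} (λ _ → k)
litR zero    = zer , λ _ → zer↦
litR (suc k) = sucR (litR k)

natrec : ℕ → (ℕ → ℕ → ℕ) → ℕ → ℕ
natrec z s zero    = z
natrec z s (suc k) = s k (natrec z s k)

natrecR : ∀ {n} {k z : Env n → ℕ} {s : Env (suc (suc n)) → ℕ} → Rec z → Rec s → Rec k →
          Rec (λ xs → natrec (z xs) (λ i y → s (i , y , xs)) (k xs))
natrecR {n} {k} {z} {s} (cz , hz) (cs , hs) K =
  compR {h = λ (j , xs) → natrec (z xs) (λ i y → s (i , y , xs)) j}
    (prec cz cs , λ (j , xs) → go j xs)
    (λ xs → k xs , xs) λ { zero → K ; (suc i) → lookupR i }
  where
  go : ∀ j xs → prec cz cs [ j ∷ toVec xs ]↦ natrec (z xs) (λ i y → s (i , y , xs)) j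
  go zero    xs = prec↦zero (hz xs)
  go (suc j) xs = prec↦suc (go j xs) (hs (j , natrec (z xs) (λ i y → s (i , y , xs)) j , xs))

sumTo : ℕ → (ℕ → ℕ) → ℕ
sumTo zero    f = 0
sumTo (suc n) f = sumTo n f + f n

anyTo : ℕ → (ℕ → Bool) → Bool
anyTo zero    p = false
anyTo (suc n) p = anyTo n p ∨ p n

-- p is not tested at 0, which is the value if no positive j ≤ n satisfies p.
maxTo : ℕ → (ℕ → Bool) → ℕ
maxTo zero    p = 0
maxTo (suc n) p = if p (suc n) then suc n else maxTo n p

module _ {n : ℕ} where

  private variable
    f g : Env n → ℕ
    p q : Env n → Bool

  -- A recursion of length `χ (p xs)`, which is 0 or 1, starts from the second branch and overwrites
  -- it with the first.
  ifR : RecB p → Rec f → Rec g → Rec (λ xs → if p xs then f xs else g xs)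
  ifR {p} {f} {g} P F G = Rec-cong (λ xs → lem (p xs))
    (natrecR {s = λ (_ , _ , xs) → f xs} G
      (compR F (λ (_ , _ , xs) → xs) λ i → lookupR (suc (suc i))) P)
    where
    lem : ∀ b {x y : ℕ} → natrec y (λ _ _ → x) (χ b) ≡ (if b then x else y)
    lem true  = refl
    lem false = refl

  falseR : RecB {n} (λ _ → false)
  falseR = litR 0

  ∧R : RecB p → RecB q → RecB (λ xs → p xs ∧ q xs)
  ∧R {p} {q} P Q = Rec-cong (λ xs → lem (p xs)) (ifR P Q falseR)
    where
    lem : ∀ b {c} → (if b then χ c else 0) ≡ χ (b ∧ c)
    lem true  = refl
    lem false = refl

  +R : Rec f → Rec g → Rec (λ xs → f xs + g xs)
  +R {f} {g} F G = Rec-cong (λ xs → lem (f xs) (g xs)) (natrecR G (sucR v1) F)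
    where
    lem : ∀ a b → natrec b (λ _ → suc) a ≡ a + b
    lem zero    b = refl
    lem (suc a) b = cong suc (lem a b)

*R₂ : Rec₂ _*_
*R₂ = Rec-cong (λ (a , b , _) → lem a b)
        (natrecR {z = λ _ → 0} {s = λ (_ , y , _ , b , _) → b + y} (litR 0) (+R v3 v1) v0)
  where
  lem : ∀ a b → natrec 0 (λ _ → b +_) a ≡ a * b
  lem zero    b = refl
  lem (suc a) b = cong (b +_) (lem a b)

predR : ∀ {n} {f : Env n → ℕ} → Rec f → Rec (λ xs → pred (f xs))
predR {n} {f} F = Rec-cong (λ xs → lem (f xs)) (natrecR {z = λ _ → 0} (litR 0) v0 F)
  where
  lem : ∀ a → natrec 0 (λ i _ → i) a ≡ pred a
  lem zero    = refl
  lem (suc a) = refl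

∸R₂ : Rec₂ _∸_
∸R₂ = Rec-cong (λ (a , b , _) → lem a b) (natrecR v0 (predR v1) v1)
  where
  lem : ∀ a b → natrec a (λ _ → pred) b ≡ a ∸ b
  lem a zero    = refl
  lem a (suc b) = trans (cong pred (lem a b)) (pred[m∸n]≡m∸[1+n] a b)

^R₂ : Rec₂ _^_
^R₂ = Rec-cong (λ (a , b , _) → lem a b)
        (natrecR {z = λ _ → 1} {s = λ (_ , y , a , _) → a * y} (litR 1) (app₂ *R₂ v2 v1) v1)
  where
  lem : ∀ a b → natrec 1 (λ _ → a *_) b ≡ a ^ b
  lem a zero    = refl
  lem a (suc b) = cong (a *_) (lem a b)

module _ {n : ℕ} where

  private variable
    f g : Env n → ℕ
    s   : Env (suc n) → ℕ
    r   : Env (suc n) → Bool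

  *R : Rec f → Rec g → Rec (λ xs → f xs * g xs)
  *R = app₂ *R₂

  ∸R : Rec f → Rec g → Rec (λ xs → f xs ∸ g xs)
  ∸R = app₂ ∸R₂

  ^R : Rec f → Rec g → Rec (λ xs → f xs ^ g xs)
  ^R = app₂ ^R₂

  <ᵇR : Rec f → Rec g → RecB (λ xs → f xs <ᵇ g xs)
  <ᵇR {f} {g} F G = Rec-cong (λ xs → lem (f xs) (g xs)) (∸R (litR 1) (∸R (sucR F) G))
    where
    lem : ∀ a b → 1 ∸ (suc a ∸ b) ≡ χ (a <ᵇ b)
    lem a       zero    = 0∸n≡0 a
    lem zero    (suc b) = cong (1 ∸_) (0∸n≡0 b)
    lem (suc a) (suc b) = lem a b

  ≤ᵇR : Rec f → Rec g → RecB (λ xs → f xs ≤ᵇ g xs)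
  ≤ᵇR {f} {g} F G = Rec-cong (λ xs → lem (f xs) (g xs)) (<ᵇR F (sucR G))
    where
    lem : ∀ a b → χ (a <ᵇ suc b) ≡ χ (a ≤ᵇ b)
    lem zero    b = refl
    lem (suc a) b = refl

  ≡ᵇR : Rec f → Rec g → RecB (λ xs → f xs ≡ᵇ g xs)
  ≡ᵇR {f} {g} F G = Rec-cong (λ xs → cong χ (lem (f xs) (g xs)))
                     (∧R (<ᵇR F (sucR G)) (<ᵇR G (sucR F)))
    where
    lem : ∀ a b → (a <ᵇ suc b) ∧ (b <ᵇ suc a) ≡ (a ≡ᵇ b)
    lem zero    zero    = refl
    lem zero    (suc b) = refl
    lem (suc a) zero    = refl
    lem (suc a) (suc b) = lem a b

  sumToR : Rec f → Rec s → Rec (λ xs → sumTo (f xs) (λ i → s (i , xs)))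
  sumToR {f} {s} F S = Rec-cong (λ xs → lem (f xs))
    (natrecR {z = λ _ → 0} {s = λ (i , y , xs) → y + s (i , xs)} (litR 0)
      (+R v1 (compR S (λ (i , _ , xs) → i , xs) λ { zero → v0 ; (suc j) → lookupR (suc (suc j)) })) F)
    where
    lem : ∀ k {t : ℕ → ℕ} → natrec 0 (λ i y → y + t i) k ≡ sumTo k t
    lem zero    = refl
    lem (suc k) {t} = cong (_+ t k) (lem k)

  -- Bounded search becomes arithmetic: some test succeeds just if the sum of the characteristic
  -- values is positive.
  anyToR : Rec f → RecB r → RecB (λ xs → anyTo (f xs) (λ i → r (i , xs)))
  anyToR {f} {r} F R = Rec-cong (λ xs → lem (f xs)) (<ᵇR (litR 0) (sumToR F R))
    where
    pos : ∀ a {b} → (0 <ᵇ (a + χ b)) ≡ ((0 <ᵇ a) ∨ b)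
    pos zero    {true}  = refl
    pos zero    {false} = refl
    pos (suc a) = refl
    lem : ∀ k {t : ℕ → Bool} → χ (0 <ᵇ sumTo k (λ i → χ (t i))) ≡ χ (anyTo k t)
    lem zero    = refl
    lem (suc k) {t} = cong χ (trans (pos (sumTo k (λ i → χ (t i))))
      (cong (_∨ t k) (χ-inj (lem k))))
      where
      χ-inj : ∀ {b c} → χ b ≡ χ c → b ≡ c
      χ-inj {true}  {true}  _ = refl
      χ-inj {false} {false} _ = refl

  maxToR : Rec f → RecB r → Rec (λ xs → maxTo (f xs) (λ i → r (i , xs)))
  maxToR {f} {r} F R = Rec-cong (λ xs → lem (f xs))
    (natrecR {z = λ _ → 0} {s = λ (i , y , xs) → if r (suc i , xs) then suc i else y} (litR 0)
      (ifR {p = λ (i , y , xs) → r (suc i , xs)}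
           (compR R (λ (i , _ , xs) → suc i , xs) λ { zero → sucR v0 ; (suc j) → lookupR (suc (suc j)) })
           (sucR v0) v1) F)
    where
    lem : ∀ k {t : ℕ → Bool} → natrec 0 (λ i y → if t (suc i) then suc i else y) k ≡ maxTo k t
    lem zero = refl
    lem (suc k) {t} = cong (if t (suc k) then suc k else_) (lem k)

iter : (ℕ → ℕ) → ℕ → ℕ → ℕ
iter h zero    x = x
iter h (suc k) x = h (iter h k x)

iterR : ∀ {h} → Rec₁ h → Rec₂ (iter h)
iterR {h} H = Rec-cong (λ (k , x , _) → lem k x)
  (natrecR {s = λ (_ , y , _) → h y} v1 (app₁ {h = h} H v1) v0)
  where
  lem : ∀ k x → natrec x (λ _ → h) k ≡ iter h k x
  lem zero    x = refl
  lem (suc k) x = cong h (lem k x)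

-- Bounded maximisation and pairing

maxTo-≤ : ∀ n p → maxTo n p ≤ n
maxTo-≤ zero    p = z≤n
maxTo-≤ (suc n) p with p (suc n)
... | true  = ≤-refl
... | false = m≤n⇒m≤1+n (maxTo-≤ n p)

≤-maxTo : ∀ n p {j} → j ≤ n → T (p j) → j ≤ maxTo n p
≤-maxTo zero    p j≤n pj = j≤n
≤-maxTo (suc n) p {j} j≤n pj with p (suc n) in eq
... | true  = j≤n
... | false with m≤n⇒m<n∨m≡n j≤n
...   | inj₁ j<1+n = ≤-maxTo n p (s≤s⁻¹ j<1+n) pj
...   | inj₂ refl  = ⊥-elim (subst T eq pj)

maxTo-sat : ∀ n p → 0 < maxTo n p → T (p (maxTo n p))
maxTo-sat (suc n) p pos with p (suc n) in eq
... | true  = subst T (sym eq) _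
... | false = maxTo-sat n p pos

maxTo-mono : ∀ n {p q} → (∀ j → T (p j) → T (q j)) → maxTo n p ≤ maxTo n q
maxTo-mono n {p} {q} imp with maxTo n p | maxTo-sat n p | maxTo-≤ n p
... | zero  | _   | _  = z≤n
... | suc v | sat | le = ≤-maxTo n q le (imp _ (sat z<s))

opaque

  -- Since `b ≤ a + b`, the code lies strictly below the square of `a + b + 1`, so its integer
  -- square root recovers `a + b`.
  ⟪_,_⟫ : ℕ → ℕ → ℕ
  ⟪ a , b ⟫ = (a + b) * (a + b) + b

  private
    root : ℕ → ℕ
    root z = maxTo z (λ j → j * j ≤ᵇ z)

    m≤m*m : ∀ m → m ≤ m * m
    m≤m*m zero    = z≤n
    m≤m*m (suc m) = m≤m*n (suc m) (suc m)

    root-pair : ∀ a b → root ⟪ a , b ⟫ ≡ a + b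
    root-pair a b = ≤-antisym upper
      (≤-maxTo z _ (≤-trans (m≤m*m r) (m≤m+n _ b)) (≤⇒≤ᵇ (m≤m+n (r * r) b)))
      where
      r z : ℕ
      r = a + b
      z = ⟪ a , b ⟫
      z<[1+r]² : z < suc r * suc r
      z<[1+r]² = s≤s $ begin
        r * r + b        ≡⟨ +-comm (r * r) b ⟩
        b + r * r        ≤⟨ +-mono-≤ (m≤n+m b a) (*-monoʳ-≤ r (n≤1+n r)) ⟩
        r + r * suc r    ∎ where open ≤-Reasoning
      upper : root z ≤ r
      upper with root z ≤? r
      ... | yes root≤r = root≤r
      ... | no    r<root = contradiction
        (<-≤-trans z<[1+r]² (≤-trans (*-mono-≤ (≰⇒> r<root) (≰⇒> r<root))
          (≤ᵇ⇒≤ _ _ (maxTo-sat z _ (≤-<-trans z≤n (≰⇒> r<root))))))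
        (<-irrefl refl)

  π₁ π₂ : ℕ → ℕ
  π₂ z = z ∸ root z * root z
  π₁ z = root z ∸ π₂ z

  π₂-pair : ∀ a b → π₂ ⟪ a , b ⟫ ≡ b
  π₂-pair a b rewrite root-pair a b = m+n∸m≡n ((a + b) * (a + b)) b

  π₁-pair : ∀ a b → π₁ ⟪ a , b ⟫ ≡ a
  π₁-pair a b rewrite π₂-pair a b | root-pair a b = m+n∸n≡m a b

  -- Makes an index `⟪ enc c , n ⟫` at least as large as the number `n` of changes that it records.
  n≤⟪m,n⟫ : ∀ m n → n ≤ ⟪ m , n ⟫
  n≤⟪m,n⟫ m n = m≤n+m n _

  pairR₂ : Rec₂ ⟪_,_⟫
  pairR₂ = +R (*R (+R v0 v1) (+R v0 v1)) v1

  private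
    rootR : Rec₁ root
    rootR = maxToR v0 (≤ᵇR (*R v0 v0) v1)

  π₂R₁ : Rec₁ π₂
  π₂R₁ = ∸R v0 (*R rootR rootR)

  π₁R₁ : Rec₁ π₁
  π₁R₁ = ∸R rootR π₂R₁

-- A universal machine

cons : ℕ → ℕ → ℕ
cons a l = suc ⟪ a , l ⟫

hd tl : ℕ → ℕ
hd l = π₁ (pred l)
tl l = π₂ (pred l)

-- A state ⟪ K , v ⟫ of the universal machine is a stack K of instructions
-- ⟪ tag , payload ⟫ together with a current value v, which is a number or a list
-- of numbers.  Tags 0-4, 8 and 10 stand for the constructors of Code (2 and 3 for proj),
-- 0 and 5 for vectors of codes; 6 and 7 continue 5, 9 continues 8, and 11 continues 10.
exec : (tag p K v : ℕ) → ℕ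
exec tag p K v =
  if tag ≡ᵇ 0 then ⟪ K , 0 ⟫
  else if tag ≡ᵇ 1 then ⟪ K , suc (hd v) ⟫
  else if tag ≡ᵇ 2 then ⟪ K , hd v ⟫
  else if tag ≡ᵇ 3 then ⟪ cons p K , tl v ⟫
  else if tag ≡ᵇ 4 then ⟪ cons (π₂ p) (cons (π₁ p) K) , v ⟫
  else if tag ≡ᵇ 5 then ⟪ cons (π₁ p) (cons ⟪ 6 , ⟪ π₂ p , v ⟫ ⟫ K) , v ⟫
  else if tag ≡ᵇ 6 then ⟪ cons (π₁ p) (cons ⟪ 7 , v ⟫ K) , π₂ p ⟫
  else if tag ≡ᵇ 7 then ⟪ K , cons p v ⟫
  else if tag ≡ᵇ 8 then
    (if hd v ≡ᵇ 0 then ⟪ cons (π₁ p) K , tl v ⟫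
     else ⟪ cons ⟪ 8 , p ⟫ (cons ⟪ 9 , ⟪ π₂ p , ⟪ pred (hd v) , tl v ⟫ ⟫ ⟫ K)
          , cons (pred (hd v)) (tl v) ⟫)
  else if tag ≡ᵇ 9 then ⟪ cons (π₁ p) K , cons (π₁ (π₂ p)) (cons v (π₂ (π₂ p))) ⟫
  else if tag ≡ᵇ 10 then ⟪ cons p (cons ⟪ 11 , ⟪ p , ⟪ 0 , v ⟫ ⟫ ⟫ K) , cons 0 v ⟫
  else
    (if v ≡ᵇ 0 then ⟪ K , π₁ (π₂ p) ⟫
     else ⟪ cons (π₁ p) (cons ⟪ 11 , ⟪ π₁ p , ⟪ suc (π₁ (π₂ p)) , π₂ (π₂ p) ⟫ ⟫ ⟫ K)
          , cons (suc (π₁ (π₂ p))) (π₂ (π₂ p)) ⟫)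

step : ℕ → ℕ
step s = if π₁ s ≡ᵇ 0 then s
         else exec (π₁ (hd (π₁ s))) (π₂ (hd (π₁ s))) (tl (π₁ s)) (π₂ s)

encFin : ∀ {n} → Fin n → ℕ
encFin zero    = ⟪ 2 , 0 ⟫
encFin (suc i) = ⟪ 3 , encFin i ⟫

mutual

  enc : ∀ {n} → Code n → ℕ
  enc zer         = ⟪ 0 , 0 ⟫
  enc succ        = ⟪ 1 , 0 ⟫
  enc (proj i)    = encFin i
  enc (comp c ds) = ⟪ 4 , ⟪ enc c , encCodes ds ⟫ ⟫
  enc (prec c d)  = ⟪ 8 , ⟪ enc c , enc d ⟫ ⟫
  enc (mu c)      = ⟪ 10 , enc c ⟫

  encCodes : ∀ {m n} → Vec (Code n) m → ℕ
  encCodes []       = ⟪ 0 , 0 ⟫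
  encCodes (d ∷ ds) = ⟪ 5 , ⟪ enc d , encCodes ds ⟫ ⟫

encVec : ∀ {n} → Vec ℕ n → ℕ
encVec []       = 0
encVec (x ∷ xs) = cons x (encVec xs)

-- Correctness of the universal machine.

infix 4 _⟶*_
_⟶*_ : ℕ → ℕ → Set
s ⟶* s′ = ∃[ t ] iter step t s ≡ s′

iter-+ : ∀ h j k x → iter h (j + k) x ≡ iter h j (iter h k x)
iter-+ h zero    k x = refl
iter-+ h (suc j) k x = cong h (iter-+ h j k x)

⟶*-trans : ∀ {s s′ s″} → s ⟶* s′ → s′ ⟶* s″ → s ⟶* s″
⟶*-trans {s} (j , p) (k , q) = k + j , trans (iter-+ step k j s) (trans (cong (iter step k) p) q)

infixr 2 _then_
_then_ : ∀ {s s′ s″} → step s ≡ s′ → s′ ⟶* s″ → s ⟶* s″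
p then r = ⟶*-trans (1 , p) r

stop : ∀ {s} → s ⟶* s
stop = 0 , refl

hd-cons : ∀ a l → hd (cons a l) ≡ a
hd-cons = π₁-pair

tl-cons : ∀ a l → tl (cons a l) ≡ l
tl-cons = π₂-pair

step-exec : ∀ tag p K v → step ⟪ cons ⟪ tag , p ⟫ K , v ⟫ ≡ exec tag p K v
step-exec tag p K v
  rewrite π₁-pair (cons ⟪ tag , p ⟫ K) v | π₂-pair (cons ⟪ tag , p ⟫ K) v
        | hd-cons ⟪ tag , p ⟫ K | tl-cons ⟪ tag , p ⟫ K
        | π₁-pair tag p | π₂-pair tag p = refl

step-4 : ∀ c ds K v → step ⟪ cons ⟪ 4 , ⟪ c , ds ⟫ ⟫ K , v ⟫ ≡ ⟪ cons ds (cons c K) , v ⟫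
step-4 c ds K v rewrite step-exec 4 ⟪ c , ds ⟫ K v | π₁-pair c ds | π₂-pair c ds = refl

step-5 : ∀ d ds K v → step ⟪ cons ⟪ 5 , ⟪ d , ds ⟫ ⟫ K , v ⟫ ≡
                      ⟪ cons d (cons ⟪ 6 , ⟪ ds , v ⟫ ⟫ K) , v ⟫
step-5 d ds K v rewrite step-exec 5 ⟪ d , ds ⟫ K v | π₁-pair d ds | π₂-pair d ds = refl

step-6 : ∀ ds xs K v → step ⟪ cons ⟪ 6 , ⟪ ds , xs ⟫ ⟫ K , v ⟫ ≡ ⟪ cons ds (cons ⟪ 7 , v ⟫ K) , xs ⟫
step-6 ds xs K v rewrite step-exec 6 ⟪ ds , xs ⟫ K v | π₁-pair ds xs | π₂-pair ds xs = refl

step-8-zero : ∀ c d K v → step ⟪ cons ⟪ 8 , ⟪ c , d ⟫ ⟫ K , cons 0 v ⟫ ≡ ⟪ cons c K , v ⟫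
step-8-zero c d K v
  rewrite step-exec 8 ⟪ c , d ⟫ K (cons 0 v) | hd-cons 0 v | tl-cons 0 v | π₁-pair c d = refl

step-8-suc : ∀ c d k K v → step ⟪ cons ⟪ 8 , ⟪ c , d ⟫ ⟫ K , cons (suc k) v ⟫ ≡
             ⟪ cons ⟪ 8 , ⟪ c , d ⟫ ⟫ (cons ⟪ 9 , ⟪ d , ⟪ k , v ⟫ ⟫ ⟫ K) , cons k v ⟫
step-8-suc c d k K v
  rewrite step-exec 8 ⟪ c , d ⟫ K (cons (suc k) v) | hd-cons (suc k) v | tl-cons (suc k) v
        | π₂-pair c d = refl

step-9 : ∀ d k xs K v → step ⟪ cons ⟪ 9 , ⟪ d , ⟪ k , xs ⟫ ⟫ ⟫ K , v ⟫ ≡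
                        ⟪ cons d K , cons k (cons v xs) ⟫
step-9 d k xs K v
  rewrite step-exec 9 ⟪ d , ⟪ k , xs ⟫ ⟫ K v | π₁-pair d ⟪ k , xs ⟫ | π₂-pair d ⟪ k , xs ⟫
        | π₁-pair k xs | π₂-pair k xs = refl

step-11-zero : ∀ c z xs K → step ⟪ cons ⟪ 11 , ⟪ c , ⟪ z , xs ⟫ ⟫ ⟫ K , 0 ⟫ ≡ ⟪ K , z ⟫
step-11-zero c z xs K
  rewrite step-exec 11 ⟪ c , ⟪ z , xs ⟫ ⟫ K 0 | π₂-pair c ⟪ z , xs ⟫ | π₁-pair z xs = refl

step-11-suc : ∀ c z xs K v → step ⟪ cons ⟪ 11 , ⟪ c , ⟪ z , xs ⟫ ⟫ ⟫ K , suc v ⟫ ≡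
              ⟪ cons c (cons ⟪ 11 , ⟪ c , ⟪ suc z , xs ⟫ ⟫ ⟫ K) , cons (suc z) xs ⟫
step-11-suc c z xs K v
  rewrite step-exec 11 ⟪ c , ⟪ z , xs ⟫ ⟫ K (suc v) | π₁-pair c ⟪ z , xs ⟫ | π₂-pair c ⟪ z , xs ⟫
        | π₁-pair z xs | π₂-pair z xs = refl

-- The quantification over the remaining stack `K` lets a run serve as a subroutine of any other
-- run.
Runs : ∀ {n} → ℕ → Vec ℕ n → ℕ → Set
Runs i xs y = ∀ K → ⟪ cons i K , encVec xs ⟫ ⟶* ⟪ K , y ⟫

-- Instruction 6 keeps the arguments while the first component is computed; instruction 7 then keeps
-- its result while the others are computed.
runsVec : ∀ {m n} (ds : Vec (Code n) m) {xs : Vec ℕ n} ys →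
          (∀ i → Runs (enc (lookup ds i)) xs (lookup ys i)) → Runs (encCodes ds) xs (encVec ys)
runsVec []       []       rs K = step-exec 0 0 K _ then stop
runsVec (d ∷ ds) {xs} (y ∷ ys) rs K =
  step-5 _ _ K _ then
  ⟶*-trans (rs zero _) (step-6 _ _ K y then
  ⟶*-trans (runsVec ds ys (rs ∘ suc) _) (step-exec 7 y K _ then stop))

-- Induction on the distance `j` from the candidate `z` under test to the least zero `y`.
runsMu : ∀ {n} c {xs : Vec ℕ n} y → Runs c (y ∷ xs) 0 →
         (∀ z → z < y → ∃[ k ] Runs c (z ∷ xs) (suc k)) →
         ∀ j z → j + z ≡ y → ∀ K →
         ⟪ cons c (cons ⟪ 11 , ⟪ c , ⟪ z , encVec xs ⟫ ⟫ ⟫ K) , cons z (encVec xs) ⟫ ⟶* ⟪ K , y ⟫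
runsMu c y r₀ rs zero z refl K = ⟶*-trans (r₀ _) (step-11-zero _ _ _ K then stop)
runsMu c y r₀ rs (suc j) z eq K with rs z (subst (z <_) eq (s≤s (m≤n+m z j)))
... | k , r = ⟶*-trans (r _) (step-11-suc _ _ _ K k then
                runsMu c y r₀ rs j (suc z) (trans (+-suc j z) eq) K)

runsProj : ∀ {n} (i : Fin n) (xs : Vec ℕ n) → Runs (encFin i) xs (lookup xs i)
runsProj zero (x ∷ xs) K =
  trans (step-exec 2 0 K _) (cong ⟪ K ,_⟫ (hd-cons x _)) then stop
runsProj (suc i) (x ∷ xs) K =
  trans (step-exec 3 _ K _) (cong ⟪ cons (encFin i) K ,_⟫ (tl-cons x _)) then runsProj i xs K

runs : ∀ {n} {c : Code n} {xs y} → c [ xs ]↦ y → Runs (enc c) xs y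
runs zer↦ K = step-exec 0 0 K _ then stop
runs (succ↦ {x}) K = trans (step-exec 1 0 K _) (cong (λ z → ⟪ K , suc z ⟫) (hd-cons x 0)) then stop
runs (proj↦ {xs = xs} i) K = runsProj i xs K
runs (comp↦ {ds = ds} ys hs hc) K =
  step-4 _ _ K _ then ⟶*-trans (runsVec ds ys (λ i → runs (hs i)) _) (runs hc K)
runs (prec↦zero h) K = step-8-zero _ _ K _ then runs h K
runs (prec↦suc {k = k} {y} h h′) K =
  step-8-suc _ _ k K _ then ⟶*-trans (runs h _) (step-9 _ k _ K y then runs h′ K)
runs (mu↦ {y = y} h hs) K =
  step-exec 10 _ K _ then
  runsMu _ y (runs h) (λ z z<y → proj₁ (hs z z<y) , runs (proj₂ (hs z z<y))) y 0 (+-identityʳ y) K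

step-halted : ∀ s → T (π₁ s ≡ᵇ 0) → step s ≡ s
step-halted s h with π₁ s ≡ᵇ 0
... | true = refl

iter-halted : ∀ j s → T (π₁ s ≡ᵇ 0) → iter step j s ≡ s
iter-halted zero    s h = refl
iter-halted (suc j) s h = trans (cong step (iter-halted j s h)) (step-halted s h)

-- Recursiveness of the universal machine.

module _ {n : ℕ} where

  private variable
    f g : Env n → ℕ

  pairR : Rec f → Rec g → Rec (λ xs → ⟪ f xs , g xs ⟫)
  pairR = app₂ pairR₂

  π₁R : Rec f → Rec (λ xs → π₁ (f xs))
  π₁R = app₁ π₁R₁

  π₂R : Rec f → Rec (λ xs → π₂ (f xs))
  π₂R = app₁ π₂R₁

  consR : Rec f → Rec g → Rec (λ xs → cons (f xs) (g xs))
  consR F G = sucR (pairR F G)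

  hdR : Rec f → Rec (λ xs → hd (f xs))
  hdR F = π₁R (predR F)

  tlR : Rec f → Rec (λ xs → tl (f xs))
  tlR F = π₂R (predR F)

execR : Rec₄ exec
execR =
  ifR (is 0) (pairR K (litR 0)) $
  ifR (is 1) (pairR K (sucR (hdR v))) $
  ifR (is 2) (pairR K (hdR v)) $
  ifR (is 3) (pairR (consR p K) (tlR v)) $
  ifR (is 4) (pairR (consR (π₂R p) (consR (π₁R p) K)) v) $
  ifR (is 5) (pairR (consR (π₁R p) (consR (pairR (litR 6) (pairR (π₂R p) v)) K)) v) $
  ifR (is 6) (pairR (consR (π₁R p) (consR (pairR (litR 7) v) K)) (π₂R p)) $
  ifR (is 7) (pairR K (consR p v)) $
  ifR (is 8)
    (ifR (≡ᵇR (hdR v) (litR 0)) (pairR (consR (π₁R p) K) (tlR v))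
      (pairR (consR (pairR (litR 8) p)
               (consR (pairR (litR 9) (pairR (π₂R p) (pairR (predR (hdR v)) (tlR v)))) K))
        (consR (predR (hdR v)) (tlR v)))) $
  ifR (is 9) (pairR (consR (π₁R p) K) (consR (π₁R (π₂R p)) (consR v (π₂R (π₂R p))))) $
  ifR (is 10) (pairR (consR p (consR (pairR (litR 11) (pairR p (pairR (litR 0) v))) K))
                (consR (litR 0) v)) $
  ifR (≡ᵇR v (litR 0)) (pairR K (π₁R (π₂R p)))
    (pairR (consR (π₁R p)
             (consR (pairR (litR 11) (pairR (π₁R p) (pairR (sucR (π₁R (π₂R p))) (π₂R (π₂R p))))) K))
      (consR (sucR (π₁R (π₂R p))) (π₂R (π₂R p))))
  where
  p : Rec₄ (λ _ p _ _ → p)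
  p = v1
  K : Rec₄ (λ _ _ K _ → K)
  K = v2
  v : Rec₄ (λ _ _ _ v → v)
  v = v3
  is : ∀ k → RecB {4} (λ (tag , _) → tag ≡ᵇ k)
  is k = ≡ᵇR v0 (litR k)

stepR : Rec₁ step
stepR = ifR (≡ᵇR (π₁R v0) (litR 0)) v0
  (app₄ execR (π₁R (hdR (π₁R v0))) (π₂R (hdR (π₁R v0))) (tlR (π₁R v0)) (π₂R v0))

opaque

  -- One more than the value of program π₁ e at (x , t) if it is found within s
  -- steps, and 0 otherwise.
  out : (e x t s : ℕ) → ℕ
  out e x t s =
    let r = iter step s ⟪ cons (π₁ e) 0 , cons x (cons t 0) ⟫
    in if π₁ r ≡ᵇ 0 then suc (π₂ r) else 0

  -- A halted state is fixed by `step`, so a result persists once it can be read off.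
  out-mono : ∀ {e x t s s′ v} → s ≤ s′ → out e x t s ≡ suc v → out e x t s′ ≡ suc v
  out-mono {e} {x} {t} {s} {s′} {v} s≤s′ eq = begin
    readout (iter step s′ init)              ≡⟨ cong (λ k → readout (iter step k init)) (sym (m∸n+n≡m s≤s′)) ⟩
    readout (iter step (s′ ∸ s + s) init)    ≡⟨ cong readout (iter-+ step (s′ ∸ s) s init) ⟩
    readout (iter step (s′ ∸ s) (iter step s init))
                                             ≡⟨ cong readout (iter-halted (s′ ∸ s) _ (halted _ eq)) ⟩
    readout (iter step s init)               ≡⟨ eq ⟩
    suc v ∎
    where
    open ≡-Reasoning
    init : ℕ
    init = ⟪ cons (π₁ e) 0 , cons x (cons t 0) ⟫
    readout : ℕ → ℕ
    readout r = if π₁ r ≡ᵇ 0 then suc (π₂ r) else 0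
    halted : ∀ r → readout r ≡ suc v → T (π₁ r ≡ᵇ 0)
    halted r eq with π₁ r ≡ᵇ 0
    ... | true = _

  -- Started with nothing else on the stack, a run of the program ends with the empty stack, that
  -- is, in a halted state.
  out-complete : ∀ {c : Code 2} {n x t v} → c [ x ∷ t ∷ [] ]↦ v →
                 ∃[ S ] ∀ s → S ≤ s → out ⟪ enc c , n ⟫ x t s ≡ suc v
  out-complete {c} {n} {x} {t} {v} h with runs h 0
  ... | S , eq = S , λ s S≤s → out-mono {⟪ enc c , n ⟫} {x} {t} S≤s lem
    where
    lem : out ⟪ enc c , n ⟫ x t S ≡ suc v
    lem rewrite π₁-pair (enc c) n | eq | π₁-pair 0 v | π₂-pair 0 v = refl

  outR : Rec₄ out
  outR = ifR (≡ᵇR (π₁R run) (litR 0)) (sucR (π₂R run)) (litR 0)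
    where
    run : Rec₄ (λ e x t s → iter step s ⟪ cons (π₁ e) 0 , cons x (cons t 0) ⟫)
    run = app₂ (iterR stepR) v3 (pairR (consR (π₁R v0) (litR 0)) (consR v1 (consR v2 (litR 0))))

-- The set to be constructed

-- The number of pairs x < m, t < s for which the approximation computed by program
-- π₁ e is seen, within s steps, to change at x from α to β between t and t + 1.
flips : (α β : ℕ) (e m s : ℕ) → ℕ
flips α β e m s = sumTo m λ x → sumTo s λ t →
  χ ((out e x t s ≡ᵇ suc α) ∧ (out e x (suc t) s ≡ᵇ suc β))

-- Peaks are measured in units of `1 / scale e`. An approximation with at most `n ≤ e` changes at
-- each number makes at most `e * m` flips below `m`, so `cap e` does not cut off its peaks.
scale cap : ℕ → ℕ
scale e = 4 ^ e * 16
cap e   = e * scale e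

-- With the cap out of the way, the integer part of
-- scale e * max { flips α β e m s / m : k < m < s }.
peak : (α β : ℕ) (e k s : ℕ) → ℕ
peak α β e k s = maxTo (cap e) λ j → anyTo s λ m →
  (k <ᵇ m) ∧ (j * m ≤ᵇ scale e * flips α β e m s)

-- Whether w mod 16 < 8.
window : ℕ → Bool
window w = anyTo (suc w) λ q → (q * 16 ≤ᵇ w) ∧ (w <ᵇ q * 16 + 8)

-- Adding `cap e` keeps the subtraction from truncating and, as `cap e` is a multiple of 16, does
-- not affect the window. The `suc` makes up for the rounding error of one unit in `peak-lower`.
bit : (e k s : ℕ) → Bool
bit e k s = window (suc (peak 0 1 e k s + (cap e ∸ peak 1 0 e k s)))

column : (e q : ℕ) → ℕ
column e q = 4 ^ e * suc (2 * q)

module _ (f : ℕ → ℕ) where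

  -- Each of the two peaks can rise at most `cap e` times; the strictness of the inequality leaves
  -- room for one more change, away from the initial value `false`.
  active : (e x : ℕ) → Bool
  active e x = anyTo (suc x) (λ q → x ≡ᵇ column e q) ∧ (2 * cap e <ᵇ f x)

  approx : (x s : ℕ) → Bool
  approx x s = (0 <ᵇ s) ∧ anyTo (suc x) (λ e → active e x ∧ bit e x s)

-- Computability of the approximation.

flipsR : ∀ α β → Rec₃ (flips α β)
flipsR α β = sumToR v1 (sumToR v3
  (∧R (≡ᵇR (app₄ outR v2 v1 v0 v4) (litR (suc α)))
      (≡ᵇR (app₄ outR v2 v1 (sucR v0) v4) (litR (suc β)))))

scaleR : Rec₁ scale
scaleR = *R (^R (litR 4) v0) (litR 16)

capR : Rec₁ cap
capR = *R v0 scaleR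

peakR : ∀ α β → Rec₃ (peak α β)
peakR α β = maxToR (app₁ capR v0) (anyToR v3
  (∧R (<ᵇR v3 v0)
      (≤ᵇR (*R v1 v0) (*R (app₁ scaleR v2) (app₃ (flipsR α β) v2 v0 v4)))))

windowR : RecB {1} (λ (w , _) → window w)
windowR = anyToR (sucR v0)
  (∧R (≤ᵇR (*R v0 (litR 16)) v1) (<ᵇR v1 (+R (*R v0 (litR 16)) (litR 8))))

bitR : RecB {3} (λ (e , k , s , _) → bit e k s)
bitR = app₁ {h = λ w → χ (window w)} windowR
  (sucR (+R (peakR 0 1) (∸R (app₁ capR v0) (peakR 1 0))))

columnR : Rec₂ column
columnR = *R (^R (litR 4) v0) (sucR (*R (litR 2) v1))

approx-computable : ∀ {f} → Computable f → Computable₂ (approx f)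
approx-computable {f} (c , h) = proj₁ approxR , λ x s → proj₂ approxR (x , s , _)
  where
  fR : Rec₁ f
  fR = c , λ (x , _) → h x
  activeR : RecB {2} (λ (e , x , _) → active f e x)
  activeR = ∧R (anyToR (sucR v1) (≡ᵇR v2 (app₂ columnR v1 v0)))
               (<ᵇR (*R (litR 2) (app₁ capR v0)) (app₁ fR v1))
  approxR : RecB {2} (λ (x , s , _) → approx f x s)
  approxR = ∧R (<ᵇR (litR 0) v1)
    (anyToR (sucR v0) (∧R (app₂ {h = λ e x → χ (active f e x)} activeR v0 v1)
                          (app₃ {h = λ e x s → χ (bit e x s)} bitR v0 v1 v2)))

-- Monotonicity of flips and peaks.

∧-intro : ∀ {b c} → T b → T c → T (b ∧ c)
∧-intro {true} _ h = h

∧-elim : ∀ {b c} → T (b ∧ c) → T b × T c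
∧-elim {true} h = _ , h

anyTo-intro : ∀ n p {i} → i < n → T (p i) → T (anyTo n p)
anyTo-intro (suc n) p {i} i<1+n h with anyTo n p in eq
... | true  = _
... | false with m≤n⇒m<n∨m≡n (s≤s⁻¹ i<1+n)
...   | inj₁ i<n  = ⊥-elim (subst T eq (anyTo-intro n p i<n h))
...   | inj₂ refl = h

anyTo-elim : ∀ n p → T (anyTo n p) → ∃[ i ] i < n × T (p i)
anyTo-elim (suc n) p h with anyTo n p in eq
... | true  = let i , i<n , pi = anyTo-elim n p (subst T (sym eq) _) in i , m≤n⇒m≤1+n i<n , pi
... | false = n , ≤-refl , h

χ-mono : ∀ {b c} → (T b → T c) → χ b ≤ χ c
χ-mono {true}  {true}  h = ≤-refl
χ-mono {true}  {false} h = ⊥-elim (h _)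
χ-mono {false} {c}     h = z≤n

sumTo-mono : ∀ n {f g} → (∀ i → i < n → f i ≤ g i) → sumTo n f ≤ sumTo n g
sumTo-mono zero    h = z≤n
sumTo-mono (suc n) h = +-mono-≤ (sumTo-mono n (λ i i<n → h i (m≤n⇒m≤1+n i<n))) (h n ≤-refl)

sumTo-monoˡ : ∀ {m n} f → m ≤ n → sumTo m f ≤ sumTo n f
sumTo-monoˡ {n = n} f z≤n = z≤n
sumTo-monoˡ {suc m} {suc n} f m≤n with m≤n⇒m<n∨m≡n m≤n
... | inj₂ refl = ≤-refl
... | inj₁ m<n  = ≤-trans (sumTo-monoˡ f (s≤s⁻¹ m<n)) (m≤m+n _ (f n))

seen-mono : ∀ {e x t s s′ v} → s ≤ s′ → T (out e x t s ≡ᵇ suc v) → T (out e x t s′ ≡ᵇ suc v)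
seen-mono {e} {x} {t} s≤s′ h = ≡⇒≡ᵇ _ _ (out-mono {e} {x} {t} s≤s′ (≡ᵇ⇒≡ _ _ h))

flips-mono : ∀ α β e m {s s′} → s ≤ s′ → flips α β e m s ≤ flips α β e m s′
flips-mono α β e m {s} {s′} s≤s′ = sumTo-mono m λ x _ →
  ≤-trans (sumTo-mono s λ t _ → χ-mono λ h → let a , b = ∧-elim h in
             ∧-intro (seen-mono {e} {x} {t} s≤s′ a) (seen-mono {e} {x} {suc t} s≤s′ b))
          (sumTo-monoˡ _ s≤s′)

peak-≤ : ∀ α β e k s → peak α β e k s ≤ cap e
peak-≤ α β e k s = maxTo-≤ (cap e) _

peak-mono : ∀ α β e k {s s′} → s ≤ s′ → peak α β e k s ≤ peak α β e k s′
peak-mono α β e k {s} {s′} s≤s′ = maxTo-mono (cap e) λ j h →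
  let m , m<s , hm = anyTo-elim s _ h ; k<m , le = ∧-elim hm in
  anyTo-intro s′ _ (<-≤-trans m<s s≤s′)
    (∧-intro k<m (≤⇒≤ᵇ (≤-trans (≤ᵇ⇒≤ (j * m) _ le) (*-monoʳ-≤ (scale e) (flips-mono α β e m s≤s′)))))

peak-antitone : ∀ α β e s {k k′} → k ≤ k′ → peak α β e k′ s ≤ peak α β e k s
peak-antitone α β e s {k} k≤k′ = maxTo-mono (cap e) λ j h →
  let m , m<s , hm = anyTo-elim s _ h ; k′<m , le = ∧-elim hm in
  anyTo-intro s _ m<s (∧-intro (<⇒<ᵇ (≤-<-trans k≤k′ (<ᵇ⇒< _ m k′<m))) le)

peak-attained : ∀ α β e k s → 0 < peak α β e k s →
                ∃[ m ] k < m × peak α β e k s * m ≤ scale e * flips α β e m s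
peak-attained α β e k s pos =
  let m , m<s , hm = anyTo-elim s _ (maxTo-sat (cap e) _ pos) ; k<m , le = ∧-elim hm in
  m , <ᵇ⇒< k m k<m , ≤ᵇ⇒≤ _ _ le

≤-peak : ∀ α β e k s {m j} → k < m → m < s → j ≤ cap e →
         j * m ≤ scale e * flips α β e m s → j ≤ peak α β e k s
≤-peak α β e k s {m} {j} k<m m<s j≤cap le =
  ≤-maxTo (cap e) _ j≤cap (anyTo-intro s _ m<s (∧-intro (<⇒<ᵇ k<m) (≤⇒≤ᵇ le)))

-- Limits and densities of n-c.e. sets

Eventually : (ℕ → Set) → Set
Eventually P = ∃[ N ] ∀ n → N ≤ n → P n

Eventually-zipWith : ∀ {P Q R : ℕ → Set} → (∀ n → P n → Q n → R n) →
                     Eventually P → Eventually Q → Eventually R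
Eventually-zipWith h (M , p) (N , q) = M ⊔ N , λ n le →
  h n (p n (≤-trans (m≤m⊔n M N) le)) (q n (≤-trans (m≤n⊔m M N) le))

Eventually-∀< : ∀ k {P : ℕ → ℕ → Set} → (∀ i → i < k → Eventually (P i)) →
                Eventually (λ n → ∀ i → i < k → P i n)
Eventually-∀< zero    h = 0 , λ n _ i ()
Eventually-∀< (suc k) {P} h =
  Eventually-zipWith (λ n hk h< i i<1+k → glue n hk h< i (m≤n⇒m<n∨m≡n (s≤s⁻¹ i<1+k)))
    (h k ≤-refl) (Eventually-∀< k (λ i i<k → h i (m≤n⇒m≤1+n i<k)))
  where
  glue : ∀ n → P k n → (∀ i → i < k → P i n) → ∀ i → i < k ⊎ i ≡ k → P i n
  glue n hk h< i (inj₁ i<k)  = h< i i<k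
  glue n hk h< i (inj₂ refl) = hk

count≡sumTo : ∀ X m → count X m ≡ sumTo m (χ ∘ X)
count≡sumTo X zero    = refl
count≡sumTo X (suc m) = begin
  count X (suc m)                                       ≡⟨ cong (length ∘ filterᵇ X) (sym (upTo-∷ʳ m)) ⟩
  length (filterᵇ X (upTo m ++ (m ∷ [])))                  ≡⟨ cong length (filter-++ (T? ∘ X) (upTo m) (m ∷ [])) ⟩
  length (filterᵇ X (upTo m) ++ filterᵇ X (m ∷ []))        ≡⟨ length-++ (filterᵇ X (upTo m)) ⟩
  count X m + length (filterᵇ X (m ∷ []))                  ≡⟨ cong₂ _+_ (count≡sumTo X m) single ⟩
  sumTo m (χ ∘ X) + χ (X m)                             ∎
  where
  open ≡-Reasoning
  single : length (filterᵇ X (m ∷ [])) ≡ χ (X m)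
  single with X m
  ... | true  = refl
  ... | false = refl

-- Stabilisation of monotone sequences and of the peaks.

module _ (em : ExcludedMiddle 0ℓ) where

  opaque

    -- Excluded middle decides whether `h` ever exceeds its current value; each time it does, the
    -- remaining room `d` below the bound shrinks.
    stabilises-↑ : ∀ (h : ℕ → ℕ) b → (∀ {s s′} → s ≤ s′ → h s ≤ h s′) → (∀ s → h s ≤ b) →
                   ∃[ v ] Eventually (λ s → h s ≡ v)
    stabilises-↑ h b mono bd = go b 0 (m≤n+m b (h 0))
      where
      go : ∀ d s₀ → b ≤ h s₀ + d → ∃[ v ] Eventually (λ s → h s ≡ v)
      go d s₀ le with em {∃[ s ] s₀ ≤ s × h s₀ < h s}
      ... | no none = h s₀ , s₀ , λ s s₀≤s → ≤-antisym (≮⇒≥ (λ lt → none (s , s₀≤s , lt))) (mono s₀≤s)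
      go zero    s₀ le | yes (s , _ , lt) =
        contradiction (<-≤-trans lt (≤-trans (bd s) (subst (b ≤_) (+-identityʳ _) le))) (<-irrefl refl)
      go (suc d) s₀ le | yes (s , _ , lt) =
        go d s (≤-trans (subst (b ≤_) (+-suc _ d) le) (+-monoˡ-≤ d lt))

    stabilises-↓ : ∀ (h : ℕ → ℕ) → (∀ {s s′} → s ≤ s′ → h s′ ≤ h s) →
                   ∃[ v ] Eventually (λ s → h s ≡ v)
    stabilises-↓ h anti = go (h 0) 0 ≤-refl
      where
      go : ∀ d s₀ → h s₀ ≤ d → ∃[ v ] Eventually (λ s → h s ≡ v)
      go d s₀ le with em {∃[ s ] s₀ ≤ s × h s < h s₀}
      ... | no none = h s₀ , s₀ , λ s s₀≤s → ≤-antisym (anti s₀≤s) (≮⇒≥ (λ lt → none (s , s₀≤s , lt)))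
      go zero    s₀ le | yes (s , _ , lt) = contradiction (<-≤-trans lt le) λ ()
      go (suc d) s₀ le | yes (s , _ , lt) = go d s (s≤s⁻¹ (<-≤-trans lt le))

    -- The running number of changes is monotone and bounded; once it is constant, no change occurs.
    stabilises-Bool : ∀ (h : ℕ → Bool) {k} → AtMost k (λ s → h s xor h (suc s)) →
                      ∃[ b ] Eventually (λ s → h s ≡ b)
    stabilises-Bool h {k} few
      with stabilises-↑ (λ m → sumTo m (λ s → χ (h s xor h (suc s)))) k (sumTo-monoˡ _)
             (λ m → subst (_≤ k) (count≡sumTo _ m) (few m))
    ... | v , S , const-sum = h S , S , λ n S≤n → subst (λ n → h n ≡ h S) (m∸n+n≡m S≤n) (go (n ∸ S))
      where
      χ-xor : ∀ b c → χ (b xor c) ≡ 0 → c ≡ b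
      χ-xor true  true  _ = refl
      χ-xor false false _ = refl
      unchanged : ∀ n → S ≤ n → h (suc n) ≡ h n
      unchanged n S≤n = χ-xor _ _ (+-cancelˡ-≡ (sumTo n _) _ _
        (trans (const-sum (suc n) (m≤n⇒m≤1+n S≤n)) (trans (sym (const-sum n S≤n)) (sym (+-identityʳ _)))))
      go : ∀ d → h (d + S) ≡ h S
      go zero    = refl
      go (suc d) = trans (unchanged (d + S) (m≤n+m S d)) (go d)

    -- For fixed `k` the peak rises with `s` up to its cap, and these limits fall as `k` grows. Two
    -- of them are compared at a stage where both have been reached.
    peak-limit : ∀ α β e → ∃[ v ] Eventually (λ k → Eventually (λ s → peak α β e k s ≡ v))
    peak-limit α β e = proj₁ outer , proj₁ (proj₂ outer) ,
      λ k K≤k → proj₁ (proj₂ (inner k)) , λ s S≤s →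
        trans (proj₂ (proj₂ (inner k)) s S≤s) (proj₂ (proj₂ outer) k K≤k)
      where
      inner : ∀ k → ∃[ v ] Eventually (λ s → peak α β e k s ≡ v)
      inner k = stabilises-↑ (peak α β e k) (cap e) (peak-mono α β e k) (peak-≤ α β e k)
      anti : ∀ {k k′} → k ≤ k′ → proj₁ (inner k′) ≤ proj₁ (inner k)
      anti {k} {k′} k≤k′ with inner k | inner k′
      ... | v , S , hv | v′ , S′ , hv′ = begin
        v′                       ≡⟨ sym (hv′ (S ⊔ S′) (m≤n⊔m S S′)) ⟩
        peak α β e k′ (S ⊔ S′)   ≤⟨ peak-antitone α β e (S ⊔ S′) k≤k′ ⟩
        peak α β e k (S ⊔ S′)    ≡⟨ hv (S ⊔ S′) (m≤m⊔n S S′) ⟩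
        v                        ∎
        where open ≤-Reasoning
      outer : ∃[ v ] Eventually (λ k → proj₁ (inner k) ≡ v)
      outer = stabilises-↓ (proj₁ ∘ inner) anti

-- Scale e times the upper density of the flips lies between v and v + 1.
module PeakLimit {α β e v : ℕ} (lim : Eventually (λ k → Eventually (λ s → peak α β e k s ≡ v))) where

  private
    K : ℕ
    K = proj₁ lim

    h : ∀ k → K ≤ k → Eventually (λ s → peak α β e k s ≡ v)
    h = proj₂ lim

  attained : ∀ k → ∃[ m ] k < m × Eventually (λ s → v * m ≤ scale e * flips α β e m s)
  attained k with v ≟ 0
  -- The value 0 is the default of `maxTo` and certifies no `m`, but the inequality is then trivial
  -- for any `m`.
  ... | yes refl = suc k , ≤-refl , 0 , λ _ _ → z≤n
  ... | no v≢0 with h (k ⊔ K) (m≤n⊔m k K)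
  ...     | S , hS with peak-attained α β e (k ⊔ K) S
                          (subst (0 <_) (sym (hS S ≤-refl)) (n≢0⇒n>0 v≢0))
  ...       | m , lt , le = m , ≤-<-trans (m≤m⊔n k K) lt , S , λ s S≤s →
    ≤-trans (subst (λ u → u * m ≤ _) (hS S ≤-refl) le) (*-monoʳ-≤ (scale e) (flips-mono α β e m S≤s))

  -- A violation at `m` persists at later stages and would lift the peak to `suc v` at a stage where
  -- it has settled at `v`.
  below : (∀ m s → flips α β e m s ≤ e * m) →
          Eventually (λ m → ∀ s → scale e * flips α β e m s < suc v * m)
  below bd with h K ≤-refl
  ...   | S , hS = suc K , λ m K<m s → ≰⇒> λ le → exceed m K<m s le (S ⊔ (s ⊔ suc m)) refl
    where
    exceed : ∀ m → K < m → ∀ s → suc v * m ≤ scale e * flips α β e m s →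
             ∀ s′ → s′ ≡ S ⊔ (s ⊔ suc m) → ⊥
    exceed m K<m s le s′ refl = <-irrefl (sym (hS s′ (m≤m⊔n S _)))
      (≤-peak α β e K s′ K<m (≤-trans (m≤n⊔m s (suc m)) (m≤n⊔m S _)) capped
        (≤-trans le (*-monoʳ-≤ (scale e) (flips-mono α β e m (≤-trans (m≤m⊔n s (suc m)) (m≤n⊔m S _))))))
      where
      -- The bound on the flips is what keeps `suc v` among the candidates of the truncated maximum.
      capped : suc v ≤ cap e
      capped = *-cancelʳ-≤ (suc v) (cap e) m {{>-nonZero (≤-<-trans z≤n K<m)}} $ begin
        suc v * m                    ≤⟨ le ⟩
        scale e * flips α β e m s    ≤⟨ *-monoʳ-≤ (scale e) (bd m s) ⟩
        scale e * (e * m)            ≡⟨ lem (scale e) e m ⟩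
        e * scale e * m              ∎
        where
        open ≤-Reasoning
        lem : ∀ a b c → a * (b * c) ≡ b * a * c
        lem = solve-∀

-- Counting an n-c.e. set by the flips of its approximation.

module Approximation {n : ℕ} {C : SetOfℕ} {g : ℕ → ℕ → Bool} {c : Code 2}
  (c-g : ∀ x s → c [ x ∷ s ∷ [] ]↦ χ (g x s))
  (hg : ∀ x → g x 0 ≡ false × Eventually (λ t → g x t ≡ C x) × AtMost n (changes g x)) where

  e : ℕ
  e = ⟪ enc c , n ⟫

  seen : (α β x s t : ℕ) → Bool
  seen α β x s t = (out e x t s ≡ᵇ suc α) ∧ (out e x (suc t) s ≡ᵇ suc β)

  out-limit : ∀ x t → Eventually (λ s → out e x t s ≡ suc (χ (g x t)))
  out-limit x t = out-complete (c-g x t)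

  -- A result seen at any stage persists to a stage where the correct one is seen, so the two
  -- coincide.
  out-sound : ∀ x t s {v} → out e x t s ≡ suc v → v ≡ χ (g x t)
  out-sound x t s eq with out-limit x t
  ... | S , h = suc-injective (trans (sym (out-mono {e} {x} {t} (m≤n⊔m S s) eq)) (h (S ⊔ s) (m≤m⊔n S s)))

  seen-sound : ∀ {α β} x s t → T (seen α β x s t) → α ≡ χ (g x t) × β ≡ χ (g x (suc t))
  seen-sound x s t h = let a , b = ∧-elim h in
    out-sound x t s (≡ᵇ⇒≡ _ _ a) , out-sound x (suc t) s (≡ᵇ⇒≡ _ _ b)

  seen⇒changes : ∀ {α β} → α ≢ β → ∀ x s t → T (seen α β x s t) → T (changes g x t)
  seen⇒changes α≢β x s t h with g x t | g x (suc t) | seen-sound x s t h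
  ... | true  | false | _ = _
  ... | false | true  | _ = _
  ... | true  | true  | refl , refl = α≢β refl
  ... | false | false | refl , refl = α≢β refl

  flips-≤ : ∀ {α β} → α ≢ β → ∀ m s → flips α β e m s ≤ e * m
  flips-≤ {α} {β} α≢β m s = ≤-trans (go m) (*-monoˡ-≤ m (n≤⟪m,n⟫ (enc c) n))
    where
    open ≤-Reasoning
    go : ∀ m → flips α β e m s ≤ n * m
    go zero    = z≤n
    go (suc m) = begin
      flips α β e m s + sumTo s (χ ∘ seen α β m s)
        ≤⟨ +-mono-≤ (go m) (sumTo-mono s λ t _ → χ-mono (seen⇒changes α≢β m s t)) ⟩
      n * m + sumTo s (χ ∘ changes g m)              ≡⟨ cong (n * m +_) (sym (count≡sumTo (changes g m) s)) ⟩
      n * m + count (changes g m) s                  ≤⟨ +-monoʳ-≤ (n * m) (proj₂ (proj₂ (hg m)) s) ⟩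
      n * m + n                                      ≡⟨ trans (+-comm (n * m) n) (sym (*-suc n m)) ⟩
      n * suc m                                      ∎

  -- Changes of `g x` alternate in direction, starting from `false`, so those upwards exceed those
  -- downwards by the final value. It suffices that the simulation has converged for all `t` up to
  -- the stage `S` where `g x` has settled.
  pointwise : ∀ x → Eventually (λ s → sumTo s (χ ∘ seen 0 1 x s) ≡ χ (C x) + sumTo s (χ ∘ seen 1 0 x s))
  pointwise x with hg x
  ... | g0 , (S , lim) , _ =
    Eventually-zipWith balance (S , λ _ le → le) (Eventually-∀< (suc S) (λ t _ → out-limit x t))
    where
    balance : ∀ s → S ≤ s → (∀ t → t < suc S → out e x t s ≡ suc (χ (g x t))) →
              sumTo s (χ ∘ seen 0 1 x s) ≡ χ (C x) + sumTo s (χ ∘ seen 1 0 x s)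
    balance s S≤s known =
      trans (telescope s) (cong (λ b → χ b + sumTo s (χ ∘ seen 1 0 x s)) (lim s S≤s))
      where
      turn : ∀ t → χ (g x t) + χ (seen 0 1 x s t) ≡ χ (g x (suc t)) + χ (seen 1 0 x s t)
      turn t with t <? S
      ... | yes t<S rewrite known t (m≤n⇒m≤1+n t<S) | known (suc t) (s≤s t<S)
          with g x t | g x (suc t)
      ...   | true  | true  = refl
      ...   | true  | false = refl
      ...   | false | true  = refl
      ...   | false | false = refl
      -- From `S` on, `g x` is constant, so by soundness no flip is seen, whether or not the
      -- simulation has converged there.
      turn t | no t≮S =
        cong₂ _+_ (cong χ same) (trans (still 0 1 (λ ())) (sym (still 1 0 (λ ()))))
        where
        S≤t : S ≤ t
        S≤t = ≮⇒≥ t≮S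
        same : g x t ≡ g x (suc t)
        same = trans (lim t S≤t) (sym (lim (suc t) (m≤n⇒m≤1+n S≤t)))
        still : ∀ α β → α ≢ β → χ (seen α β x s t) ≡ 0
        still α β α≢β with seen α β x s t in eq
        ... | false = refl
        ... | true  = let a , b = seen-sound {α} {β} x s t (subst T (sym eq) _) in
                      contradiction (trans a (trans (cong χ same) (sym b))) α≢β
      telescope : ∀ j → sumTo j (χ ∘ seen 0 1 x s) ≡ χ (g x j) + sumTo j (χ ∘ seen 1 0 x s)
      telescope zero    rewrite g0 = refl
      telescope (suc j) = begin
        u + χ (seen 0 1 x s j)                             ≡⟨ cong (_+ χ (seen 0 1 x s j)) (telescope j) ⟩
        χ (g x j) + d + χ (seen 0 1 x s j)                 ≡⟨ exchange (χ (g x j)) d _ ⟩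
        χ (g x j) + χ (seen 0 1 x s j) + d                 ≡⟨ cong (_+ d) (turn j) ⟩
        χ (g x (suc j)) + χ (seen 1 0 x s j) + d           ≡⟨ regroup (χ (g x (suc j))) _ d ⟩
        χ (g x (suc j)) + (d + χ (seen 1 0 x s j))         ∎
        where
        open ≡-Reasoning
        u d : ℕ
        u = sumTo j (χ ∘ seen 0 1 x s)
        d = sumTo j (χ ∘ seen 1 0 x s)
        exchange : ∀ a b c → a + b + c ≡ a + c + b
        exchange = solve-∀
        regroup : ∀ a b c → a + b + c ≡ a + (c + b)
        regroup = solve-∀

  flips-count : ∀ m → Eventually (λ s → flips 0 1 e m s ≡ count C m + flips 1 0 e m s)
  flips-count zero    = 0 , λ _ _ → refl
  flips-count (suc m) = Eventually-zipWith (λ s p q → begin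
      flips 0 1 e m s + sumTo s (χ ∘ seen 0 1 m s)              ≡⟨ cong₂ _+_ p q ⟩
      count C m + flips 1 0 e m s + (χ (C m) + sumTo s (χ ∘ seen 1 0 m s))
                                        ≡⟨ lem (count C m) _ (χ (C m)) _ ⟩
      count C m + χ (C m) + flips 1 0 e (suc m) s
                                        ≡⟨ cong (λ k → k + χ (C m) + flips 1 0 e (suc m) s) (count≡sumTo C m) ⟩
      sumTo (suc m) (χ ∘ C) + flips 1 0 e (suc m) s
        ≡⟨ cong (_+ flips 1 0 e (suc m) s) (sym (count≡sumTo C (suc m))) ⟩
      count C (suc m) + flips 1 0 e (suc m) s         ∎)
    (flips-count m) (pointwise m)
    where
    open ≡-Reasoning
    lem : ∀ a b c d → a + b + (c + d) ≡ a + c + (b + d)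
    lem = solve-∀

  module _ {p q : ℕ}
    (lim⁺ : Eventually (λ k → Eventually (λ s → peak 0 1 e k s ≡ p)))
    (lim⁻ : Eventually (λ k → Eventually (λ s → peak 1 0 e k s ≡ q))) where

    private
      module P⁺ = PeakLimit {0} {1} {e} {p} lim⁺
      module P⁻ = PeakLimit {1} {0} {e} {q} lim⁻

    -- A single large `m` suffices: the downward flips there reach the level `q`, while the upward
    -- ones already stay below `suc p`. The identity `flips-count` links the two.
    peak-lower : ∀ {A} → Eventually (λ m → A * m ≤ scale e * count C m + m) → A + q ≤ suc p
    peak-lower {A} (M , dense) with P⁺.below (flips-≤ λ ())
    ... | K , small with P⁻.attained (M ⊔ K)
    ...   | m , M⊔K<m , at with Eventually-zipWith (λ _ → _,_) at (flips-count m)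
    ...     | s , h with h s ≤-refl
    ...       | big , bal = s≤s⁻¹ (*-cancelʳ-< m (A + q) (suc (suc p)) (begin-strict
      (A + q) * m                                               ≡⟨ *-distribʳ-+ m A q ⟩
      A * m + q * m
        ≤⟨ +-mono-≤ (dense m (≤-trans (m≤m⊔n M K) (<⇒≤ M⊔K<m))) big ⟩
      scale e * count C m + m + scale e * flips 1 0 e m s       ≡⟨ lem (scale e) (count C m) m _ ⟩
      m + scale e * (count C m + flips 1 0 e m s)               ≡⟨ cong (λ k → m + scale e * k) (sym bal) ⟩
      m + scale e * flips 0 1 e m s
        <⟨ +-monoʳ-< m (small m (≤-trans (m≤n⊔m M K) (<⇒≤ M⊔K<m)) s) ⟩
      suc (suc p) * m                                           ∎))
      where
      open ≤-Reasoning
      lem : ∀ a b c d → a * b + c + a * d ≡ c + a * (b + d)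
      lem = solve-∀

    -- As for `peak-lower`, with the roles exchanged: `m` is chosen so that the upward flips reach
    -- the level `p`.
    peak-upper : ∀ {A} → Eventually (λ m → scale e * count C m ≤ A * m + m) → p ≤ suc (A + q)
    peak-upper {A} (M , sparse) with P⁻.below (flips-≤ λ ())
    ... | K , small with P⁺.attained (M ⊔ K)
    ...   | m , M⊔K<m , at with Eventually-zipWith (λ _ → _,_) at (flips-count m)
    ...     | s , h with h s ≤-refl
    ...       | big , bal = s≤s⁻¹ (*-cancelʳ-< m p (suc (suc (A + q))) (begin-strict
      p * m                                                     ≤⟨ big ⟩
      scale e * flips 0 1 e m s                                 ≡⟨ cong (scale e *_) bal ⟩
      scale e * (count C m + flips 1 0 e m s)                   ≡⟨ *-distribˡ-+ (scale e) (count C m) _ ⟩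
      scale e * count C m + scale e * flips 1 0 e m s
        <⟨ +-mono-≤-< (sparse m (≤-trans (m≤m⊔n M K) (<⇒≤ M⊔K<m)))
                                                                     (small m (≤-trans (m≤n⊔m M K) (<⇒≤ M⊔K<m)) s) ⟩
      A * m + m + suc q * m                                     ≡⟨ lem A m q ⟩
      suc (suc (A + q)) * m                                     ∎))
      where
      open ≤-Reasoning
      lem : ∀ a m q → a * m + m + (m + q * m) ≡ m + (m + (a + q) * m)
      lem = solve-∀

-- The density of a set given by columns

count-suc : ∀ X m → count X (suc m) ≡ count X m + χ (X m)
count-suc X m = trans (count≡sumTo X (suc m)) (cong (_+ χ (X m)) (sym (count≡sumTo X m)))

count-mono : ∀ X {m n} → m ≤ n → count X m ≤ count X n
count-mono X {m} {n} m≤n rewrite count≡sumTo X m | count≡sumTo X n = sumTo-monoˡ (χ ∘ X) m≤n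

χ≤1 : ∀ b → χ b ≤ 1
χ≤1 true  = ≤-refl
χ≤1 false = z≤n

count-+ : ∀ X k m → count X (k + m) ≤ k + count X m
count-+ X zero    m = ≤-refl
count-+ X (suc k) m = begin
  count X (suc k + m)            ≡⟨ count-suc X (k + m) ⟩
  count X (k + m) + χ (X (k + m)) ≤⟨ +-mono-≤ (count-+ X k m) (χ≤1 _) ⟩
  k + count X m + 1              ≡⟨ +-comm _ 1 ⟩
  suc k + count X m              ∎
  where open ≤-Reasoning

≤-sumTo : ∀ f {i} n → i < n → f i ≤ sumTo n f
≤-sumTo f (suc n) i<1+n with m≤n⇒m<n∨m≡n (s≤s⁻¹ i<1+n)
... | inj₁ i<n  = ≤-trans (≤-sumTo f n i<n) (m≤m+n _ _)
... | inj₂ refl = m≤n+m _ _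

-- The difference of `F` and `G` is constant from `K` on, and the sum of the values of `F` up to `K`
-- dominates what comes before.
equal-increments : ∀ (F G : ℕ → ℕ) → Eventually (λ q → F (suc q) + G q ≡ G (suc q) + F q) →
                   ∃[ c ] ∀ q → F q ≤ G q + c
equal-increments F G (K , inc) = c , λ q → go q (≤-total q K)
  where
  open ≤-Reasoning
  c : ℕ
  c = sumTo (suc K) F
  go : ∀ q → q ≤ K ⊎ K ≤ q → F q ≤ G q + c
  go q       (inj₁ q≤K) = ≤-trans (≤-sumTo F (suc K) (s≤s q≤K)) (m≤n+m c (G q))
  go zero    (inj₂ z≤n) = go zero (inj₁ z≤n)
  go (suc q) (inj₂ K≤1+q) with m≤n⇒m<n∨m≡n K≤1+q
  ... | inj₂ refl = go (suc q) (inj₁ ≤-refl)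
  ... | inj₁ K≤q  = +-cancelʳ-≤ (G q) (F (suc q)) (G (suc q) + c) $ begin
    F (suc q) + G q           ≡⟨ inc q (s≤s⁻¹ K≤q) ⟩
    G (suc q) + F q           ≤⟨ +-monoʳ-≤ (G (suc q)) (go q (inj₂ (s≤s⁻¹ K≤q))) ⟩
    G (suc q) + (G q + c)     ≡⟨ lem (G (suc q)) (G q) c ⟩
    G (suc q) + c + G q       ∎
    where
    lem : ∀ a b c → a + (b + c) ≡ a + c + b
    lem = solve-∀

-- 4 ^ i times the truncated sum of b e / (2 * 4 ^ e) over e < i.
digits : (ℕ → Bool) → ℕ → ℕ
digits b zero    = 0
digits b (suc i) = χ (b 0) * 2 * 4 ^ i + digits (b ∘ suc) i

-- The definition splits off the first digit, to suit the recursion over columns; the diagonal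
-- argument needs the last one split off.
digits-suc : ∀ b i → digits b (suc i) ≡ 4 * digits b i + 2 * χ (b i)
digits-suc b zero    = lem (χ (b 0))
  where
  lem : ∀ x → x * 2 * 1 + 0 ≡ 0 + 2 * x
  lem = solve-∀
digits-suc b (suc i) = trans (cong (χ (b 0) * 2 * 4 ^ suc i +_) (digits-suc (b ∘ suc) i))
                             (lem (χ (b 0)) (4 ^ i) (digits (b ∘ suc) i) (2 * χ (b (suc i))))
  where
  lem : ∀ x t d y → x * 2 * (4 * t) + (4 * d + y) ≡ 4 * (x * 2 * t + d) + y
  lem = solve-∀

-- The columns partition the numbers of even 2-adic valuation; the numbers 2 * column e q are
-- those of odd valuation.
Columnwise : SetOfℕ → (ℕ → Bool) → Set
Columnwise B b = (∀ e → Eventually (λ q → B (column e q) ≡ b e)) × (∀ e q → B (2 * column e q) ≡ false)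

-- Multiplication by 4 takes column `e` to column `suc e`, and likewise for the doubled columns.
columnwise-tail : ∀ {B b} → Columnwise B b → Columnwise (λ y → B (y * 4)) (b ∘ suc)
columnwise-tail {B} (h₁ , h₂) =
  (λ e → let K , h = h₁ (suc e) in
    K , λ q K≤q → trans (cong B (lem₁ (4 ^ e) (suc (2 * q)))) (h q K≤q)) ,
  (λ e q → trans (cong B (lem₂ (4 ^ e) (suc (2 * q)))) (h₂ (suc e) q))
  where
  lem₁ : ∀ t y → t * y * 4 ≡ 4 * t * y
  lem₁ = solve-∀
  lem₂ : ∀ t y → 2 * (t * y) * 4 ≡ 2 * (4 * t * y)
  lem₂ = solve-∀

-- Confines `4 ^ i` times the density to the interval from `l` to `suc l`. An additive constant in
-- place of a limit is preserved by the recursion on `i`.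
CountWithin : SetOfℕ → (l i : ℕ) → Set
CountWithin B l i = ∃[ c ] ∀ m → l * m ≤ 4 ^ i * count B m + c × 4 ^ i * count B m ≤ suc l * m + c

-- In a block of four, `4q+1` and `4q+3` are in column 0, `4q+2` is twice an element of it, and `4q`
-- is counted by `B′`.
count-blocks : ∀ {B b} → Columnwise B b → let B′ = λ y → B (y * 4) in
  Eventually λ q → count B (suc q * 4) + (χ (b 0) * 2 * q + count B′ q) ≡
                   (χ (b 0) * 2 * suc q + count B′ (suc q)) + count B (q * 4)
count-blocks {B} {b} (h₁ , h₂) with h₁ 0
... | K , h = K , λ q K≤q → begin
  count B (suc q * 4) + (x * 2 * q + count B′ q)
    ≡⟨ cong (_+ (x * 2 * q + count B′ q)) (block q) ⟩
  count B (q * 4) + χ (B (q * 4)) + χ (B (1 + q * 4)) + χ (B (2 + q * 4)) + χ (B (3 + q * 4))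
    + (x * 2 * q + count B′ q)
    ≡⟨ cong₃ (λ u v w → count B (q * 4) + χ (B (q * 4)) + χ u + χ v + χ w + (x * 2 * q + count B′ q))
         (trans (cong B (lem₁ q)) (h (2 * q) (≤-trans K≤q (m≤m+n q _))))
         (trans (cong B (lem₂ q)) (h₂ 0 q))
         (trans (cong B (lem₃ q)) (h (suc (2 * q)) (≤-trans K≤q (m≤n⇒m≤1+n (m≤m+n q _))))) ⟩
  count B (q * 4) + χ (B (q * 4)) + x + 0 + x + (x * 2 * q + count B′ q)
    ≡⟨ lem₄ (count B (q * 4)) (χ (B (q * 4))) x q (count B′ q) ⟩
  (x * 2 * suc q + (count B′ q + χ (B (q * 4)))) + count B (q * 4)
    ≡⟨ cong (λ k → x * 2 * suc q + k + count B (q * 4)) (sym (count-suc B′ q)) ⟩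
  (x * 2 * suc q + count B′ (suc q)) + count B (q * 4) ∎
  where
  open ≡-Reasoning
  B′ : SetOfℕ
  B′ y = B (y * 4)
  x : ℕ
  x = χ (b 0)
  block : ∀ q → count B (suc q * 4) ≡
    count B (q * 4) + χ (B (q * 4)) + χ (B (1 + q * 4)) + χ (B (2 + q * 4)) + χ (B (3 + q * 4))
  block q rewrite count-suc B (3 + q * 4) | count-suc B (2 + q * 4)
                | count-suc B (1 + q * 4) | count-suc B (q * 4) = refl
  cong₃ : ∀ (f : Bool → Bool → Bool → ℕ) {u u′ v v′ w w′} → u ≡ u′ → v ≡ v′ → w ≡ w′ → f u v w ≡ f u′ v′ w′
  cong₃ f refl refl refl = refl
  lem₁ : ∀ q → 1 + q * 4 ≡ 1 * (1 + 2 * (2 * q))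
  lem₁ = solve-∀
  lem₂ : ∀ q → 2 + q * 4 ≡ 2 * (1 * (1 + 2 * q))
  lem₂ = solve-∀
  lem₃ : ∀ q → 3 + q * 4 ≡ 1 * (1 + 2 * (1 + 2 * q))
  lem₃ = solve-∀
  lem₄ : ∀ a y x q c → a + y + x + 0 + x + (x * 2 * q + c) ≡ (x * 2 * (1 + q) + (c + y)) + a
  lem₄ = solve-∀

-- Up to a constant, `count B (q * 4)` is the contribution of column 0 plus `count B′ q`. The
-- induction hypothesis applies to `B′` at `q = m / 4`, and rounding `m` to a multiple of 4 costs a
-- constant.
columnwise⇒countWithin : ∀ {B b} → Columnwise B b → ∀ i → CountWithin B (digits b i) i
columnwise⇒countWithin {B} cw zero = 0 , λ m → z≤n , (begin
  1 * count B m    ≡⟨ *-identityˡ _ ⟩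
  count B m        ≡⟨ cong (count B) (sym (+-identityʳ m)) ⟩
  count B (m + 0)  ≤⟨ count-+ B m 0 ⟩
  m + 0            ≡⟨ sym (+-identityʳ (m + 0)) ⟩
  1 * m + 0        ∎)
  where open ≤-Reasoning
columnwise⇒countWithin {B} {b} cw (suc i)
  with equal-increments (λ q → count B (q * 4)) (λ q → χ (b 0) * 2 * q + count (λ y → B (y * 4)) q) (count-blocks cw)
     | equal-increments (λ q → χ (b 0) * 2 * q + count (λ y → B (y * 4)) q) (λ q → count B (q * 4))
         (let K , h = count-blocks cw in K , λ q K≤q → sym (h q K≤q))
     | columnwise⇒countWithin (columnwise-tail {B} cw) i
... | c₁ , le₁ | c₂ , le₂ | c₃ , within = c⁻ + c⁺ , λ m →
  ≤-trans (lower m) (+-monoʳ-≤ (4 ^ suc i * count B m) (m≤m+n c⁻ c⁺)) ,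
  ≤-trans (upper m) (+-monoʳ-≤ (suc (digits b (suc i)) * m) (m≤n+m c⁺ c⁻))
  where
  open ≤-Reasoning
  B′ : SetOfℕ
  B′ y = B (y * 4)
  x t d c⁻ c⁺ : ℕ
  x = χ (b 0) * 2
  t = 4 ^ i
  d = digits (b ∘ suc) i
  c⁻ = 4 * (x * t + d) + (4 * c₃ + 4 * t * c₂)
  c⁺ = 4 * c₃ + 4 * t * (c₁ + 4)
  m≤4+[m/4]*4 : ∀ m → m ≤ 4 + m / 4 * 4
  m≤4+[m/4]*4 m = ≤-trans (≤-reflexive (m≡m%n+[m/n]*n m 4)) (+-monoˡ-≤ _ (<⇒≤ (m%n<n m 4)))
  lower : ∀ m → (x * t + d) * m ≤ 4 * t * count B m + c⁻
  lower m = let q = m / 4 in begin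
    (x * t + d) * m
      ≤⟨ *-monoʳ-≤ (x * t + d) (m≤4+[m/4]*4 m) ⟩
    (x * t + d) * (4 + q * 4)
      ≡⟨ lem₁ x t d q ⟩
    4 * t * (x * q) + (4 * (d * q) + 4 * (x * t + d))
      ≤⟨ +-monoʳ-≤ (4 * t * (x * q)) (+-monoˡ-≤ _ (*-monoʳ-≤ 4 (proj₁ (within q)))) ⟩
    4 * t * (x * q) + (4 * (t * count B′ q + c₃) + 4 * (x * t + d))
      ≡⟨ lem₂ t (x * q) (count B′ q) c₃ (x * t + d) ⟩
    4 * t * (x * q + count B′ q) + (4 * (x * t + d) + 4 * c₃)
      ≤⟨ +-monoˡ-≤ _ (*-monoʳ-≤ (4 * t) (≤-trans (le₂ q) (+-monoˡ-≤ c₂ (count-mono B (m/n*n≤m m 4))))) ⟩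
    4 * t * (count B m + c₂) + (4 * (x * t + d) + 4 * c₃)
      ≡⟨ lem₃ (4 * t) (count B m) c₂ (4 * (x * t + d)) (4 * c₃) ⟩
    4 * t * count B m + c⁻ ∎
    where
    lem₁ : ∀ x t d q → (x * t + d) * (4 + q * 4) ≡ 4 * t * (x * q) + (4 * (d * q) + 4 * (x * t + d))
    lem₁ = solve-∀
    lem₂ : ∀ t u v c w → 4 * t * u + (4 * (t * v + c) + 4 * w) ≡ 4 * t * (u + v) + (4 * w + 4 * c)
    lem₂ = solve-∀
    lem₃ : ∀ t u c v w → t * (u + c) + (v + w) ≡ t * u + (v + (w + t * c))
    lem₃ = solve-∀
  upper : ∀ m → 4 * t * count B m ≤ suc (x * t + d) * m + c⁺
  upper m = let q = m / 4 in begin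
    4 * t * count B m
      ≤⟨ *-monoʳ-≤ (4 * t) (≤-trans (count-mono B (m≤4+[m/4]*4 m)) (count-+ B 4 (q * 4))) ⟩
    4 * t * (4 + count B (q * 4))
      ≤⟨ *-monoʳ-≤ (4 * t) (+-monoʳ-≤ 4 (le₁ q)) ⟩
    4 * t * (4 + (x * q + count B′ q + c₁))
      ≡⟨ lem₁ t (x * q) (count B′ q) c₁ ⟩
    4 * t * (x * q) + (4 * (t * count B′ q) + 4 * t * (c₁ + 4))
      ≤⟨ +-monoʳ-≤ (4 * t * (x * q)) (+-monoˡ-≤ _ (*-monoʳ-≤ 4 (proj₂ (within q)))) ⟩
    4 * t * (x * q) + (4 * (suc d * q + c₃) + 4 * t * (c₁ + 4))
      ≡⟨ lem₂ x t d q c₃ (4 * t * (c₁ + 4)) ⟩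
    suc (x * t + d) * (q * 4) + c⁺
      ≤⟨ +-monoˡ-≤ c⁺ (*-monoʳ-≤ (suc (x * t + d)) (m/n*n≤m m 4)) ⟩
    suc (x * t + d) * m + c⁺ ∎
    where
    lem₁ : ∀ t u v c → 4 * t * (4 + (u + v + c)) ≡ 4 * t * u + (4 * (t * v) + 4 * t * (c + 4))
    lem₁ = solve-∀
    lem₂ : ∀ x t d q c w → 4 * t * (x * q) + (4 * ((1 + d) * q + c) + w) ≡
                           (1 + (x * t + d)) * (q * 4) + (4 * c + w)
    lem₂ = solve-∀

-- Rational densities

p≤∣p∣ : ∀ p → p ℚ.≤ ℚ.∣ p ∣
p≤∣p∣ (mkℚᵘ (ℤ.+ n) d)    = ℚ.≤-refl
p≤∣p∣ (mkℚᵘ -[1+ n ] d) = *≤* (ℤ.*-monoʳ-≤-nonNeg (ℤ.+ suc d) (-≤+ {n} {suc n}))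

∣p-q∣≤r⇒p≤r+q : ∀ {p q r} → ℚ.∣ p ℚ.- q ∣ ℚ.≤ r → p ℚ.≤ r ℚ.+ q
∣p-q∣≤r⇒p≤r+q {p} {q} {r} le = begin
  p                           ≃⟨ ℚ.≃-sym (ℚ.+-identityʳ p) ⟩
  p ℚ.+ 0ℚᵘ                   ≃⟨ ℚ.+-congʳ p (ℚ.≃-sym (ℚ.+-inverseˡ q)) ⟩
  p ℚ.+ (ℚ.- q ℚ.+ q)         ≃⟨ ℚ.≃-sym (ℚ.+-assoc p (ℚ.- q) q) ⟩
  p ℚ.- q ℚ.+ q               ≤⟨ ℚ.+-monoˡ-≤ q (ℚ.≤-trans (p≤∣p∣ _) le) ⟩
  r ℚ.+ q                     ∎
  where open ℚ.≤-Reasoning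

p≤r+q⇒p-q≤r : ∀ {p q r} → p ℚ.≤ r ℚ.+ q → p ℚ.- q ℚ.≤ r
p≤r+q⇒p-q≤r {p} {q} {r} le = begin
  p ℚ.- q              ≤⟨ ℚ.+-monoˡ-≤ (ℚ.- q) le ⟩
  r ℚ.+ q ℚ.- q        ≃⟨ ℚ.+-assoc r q (ℚ.- q) ⟩
  r ℚ.+ (q ℚ.- q)      ≃⟨ ℚ.+-congʳ r (ℚ.+-inverseʳ q) ⟩
  r ℚ.+ 0ℚᵘ            ≃⟨ ℚ.+-identityʳ r ⟩
  r                    ∎
  where open ℚ.≤-Reasoning

-[p-q]≃q-p : ∀ p q → ℚ.- (p ℚ.- q) ℚ.≃ q ℚ.- p
-[p-q]≃q-p p q = begin-equality
  ℚ.- (p ℚ.- q)           ≃⟨ ℚ.≃-reflexive (ℚ.neg-distrib-+ p (ℚ.- q)) ⟩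
  ℚ.- p ℚ.+ ℚ.- (ℚ.- q)   ≃⟨ ℚ.+-congʳ (ℚ.- p) (ℚ.neg-involutive q) ⟩
  ℚ.- p ℚ.+ q             ≃⟨ ℚ.+-comm (ℚ.- p) q ⟩
  q ℚ.- p                 ∎
  where open ℚ.≤-Reasoning

∣p-q∣≤r : ∀ {p q r} → p ℚ.≤ r ℚ.+ q → q ℚ.≤ r ℚ.+ p → ℚ.∣ p ℚ.- q ∣ ℚ.≤ r
∣p-q∣≤r {p} {q} {r} le₁ le₂ with ℚ.∣ p ℚ.- q ∣ | ℚ.∣p∣≡p∨∣p∣≡-p (p ℚ.- q)
... | _ | inj₁ refl = p≤r+q⇒p-q≤r {p} {q} le₁
... | _ | inj₂ refl = ℚ.≤-respˡ-≃ (ℚ.≃-sym (-[p-q]≃q-p p q)) (p≤r+q⇒p-q≤r {q} {p} le₂)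

∣p-q∣≤r⇒q≤r+p : ∀ {p q r} → ℚ.∣ p ℚ.- q ∣ ℚ.≤ r → q ℚ.≤ r ℚ.+ p
∣p-q∣≤r⇒q≤r+p {p} {q} {r} le = ∣p-q∣≤r⇒p≤r+q {q} {p} (begin
  ℚ.∣ q ℚ.- p ∣            ≃⟨ ℚ.∣-∣-cong (ℚ.≃-sym (-[p-q]≃q-p p q)) ⟩
  ℚ.∣ ℚ.- (p ℚ.- q) ∣      ≃⟨ ℚ.∣-p∣≃∣p∣ (p ℚ.- q) ⟩
  ℚ.∣ p ℚ.- q ∣            ≤⟨ le ⟩
  r                        ∎)
  where open ℚ.≤-Reasoning

module _ (a b u m n l : ℕ) where

  private
    M N L : ℕ
    M = suc m
    N = suc n
    L = suc l

    rhs : (ℤ.+ u ℤ.* ℤ.+ N ℤ.+ ℤ.+ b ℤ.* ℤ.+ L) ℤ.* ℤ.+ M ≡ ℤ.+ ((u * N + b * L) * M)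
    rhs = trans (cong (ℤ._* ℤ.+ M) (trans (cong₂ ℤ._+_ (sym (ℤ.pos-* u N)) (sym (ℤ.pos-* b L)))
                                        (sym (ℤ.pos-+ (u * N) (b * L)))))
                (sym (ℤ.pos-* (u * N + b * L) M))

    lhs-ℕ : ∀ l a n → l * (a * n) ≡ a * (l * n)
    lhs-ℕ = solve-∀

    rhs-ℕ : ∀ u n b l m → (u * n + b * l) * m ≡ l * (b * m) + u * (m * n)
    rhs-ℕ = solve-∀

  fraction-≤ : L * (a * N) ≤ L * (b * M) + u * (M * N) →
               ℤ.+ a ℚ./ M ℚ.≤ (ℤ.+ u ℚ./ L) ℚ.+ (ℤ.+ b ℚ./ N)
  fraction-≤ le = *≤* $ subst₂ ℤ._≤_ (ℤ.pos-* a (L * N)) (sym rhs) $ +≤+ $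
    subst₂ _≤_ (lhs-ℕ L a N) (sym (rhs-ℕ u N b L M)) le

  fraction-≤⁻¹ : ℤ.+ a ℚ./ M ℚ.≤ (ℤ.+ u ℚ./ L) ℚ.+ (ℤ.+ b ℚ./ N) →
                 L * (a * N) ≤ L * (b * M) + u * (M * N)
  fraction-≤⁻¹ le = subst₂ _≤_ (sym (lhs-ℕ L a N)) (rhs-ℕ u N b L M) $
    ℤ.drop‿+≤+ $ subst₂ ℤ._≤_ (sym (ℤ.pos-* a (L * N))) rhs $ ℚ.drop-*≤* le

unit-fraction-< : ∀ {ε} → 0ℚᵘ ℚ.< ε → ∃[ l ] ℤ.+ 1 ℚ./ suc l ℚ.< ε
unit-fraction-< {mkℚᵘ (ℤ.+ 0) d} (*<* (+<+ ()))
unit-fraction-< {mkℚᵘ -[1+ n ] d} (*<* ())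
unit-fraction-< {mkℚᵘ +[1+ n ] d} _ = suc d , *<* (+<+ (begin-strict
  1 * suc d              ≡⟨ *-identityˡ (suc d) ⟩
  suc d                  <⟨ ≤-refl ⟩
  suc (suc d)            ≤⟨ m≤m+n _ _ ⟩
  suc n * suc (suc d)    ∎))
  where open ≤-Reasoning

double-unit-fraction : ∀ l → (ℤ.+ 1 ℚ./ suc l) ℚ.+ (ℤ.+ 1 ℚ./ suc l) ℚ.≃ ℤ.+ 2 ℚ./ suc l
double-unit-fraction l = *≡* (cong ℤ.+_ (lem (suc l)))
  where
  lem : ∀ l → (1 * l + 1 * l) * l ≡ 2 * (l * l)
  lem = solve-∀

-- For positive `l` and large `m`, both relative counts are within `1 / l` of the same term of the
-- sequence representing `r`, taken at an index late enough for both.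
equal-density⇒close : ∀ {X Y r} → HasDensity X r → HasDensity Y r → ∀ l →
  Eventually (λ m → l * count X m ≤ l * count Y m + 2 * m)
equal-density⇒close hX hY zero = 0 , λ _ _ → z≤n
equal-density⇒close {X} {Y} {r} hX hY (suc l)
  with hX (ℤ.+ 1 ℚ./ suc l) (*<* (+<+ ≤-refl)) | hY (ℤ.+ 1 ℚ./ suc l) (*<* (+<+ ≤-refl))
... | M , wX | N , wY = suc (M ⊔ N) , close
  where
  ε : ℚᵘ
  ε = ℤ.+ 1 ℚ./ suc l
  close : ∀ m → suc (M ⊔ N) ≤ m → suc l * count X m ≤ suc l * count Y m + 2 * m
  close (suc m) (s≤s le)
    with wX (suc m) (≤-trans (m≤m⊔n M N) (m≤n⇒m≤1+n le)) | wY (suc m) (≤-trans (m≤n⊔m M N) (m≤n⇒m≤1+n le))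
  ... | δ , δ<ε , J , hδ | δ′ , δ′<ε , K , hδ′ = *-cancelʳ-≤ _ _ (suc m) $
    subst₂ _≤_ (sym (*-assoc (suc l) (count X (suc m)) (suc m))) (lem (suc l) (count Y (suc m)) (suc m)) $
    fraction-≤⁻¹ (count X (suc m)) (count Y (suc m)) 2 m m l (begin
      ρ X (suc m)
        ≤⟨ ∣p-q∣≤r⇒p≤r+q {ρ X (suc m)} {ℝ.seq r k} (ℚ.≤-trans (hδ k (m≤m⊔n J K)) (ℚ.<⇒≤ δ<ε)) ⟩
      ε ℚ.+ ℝ.seq r k
        ≤⟨ ℚ.+-monoʳ-≤ ε (∣p-q∣≤r⇒q≤r+p {ρ Y (suc m)} {ℝ.seq r k} (ℚ.≤-trans (hδ′ k (m≤n⊔m J K)) (ℚ.<⇒≤ δ′<ε))) ⟩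
      ε ℚ.+ (ε ℚ.+ ρ Y (suc m))                  ≃⟨ ℚ.≃-sym (ℚ.+-assoc ε ε (ρ Y (suc m))) ⟩
      ε ℚ.+ ε ℚ.+ ρ Y (suc m)                    ≃⟨ ℚ.+-congˡ (ρ Y (suc m)) (double-unit-fraction l) ⟩
      ℤ.+ 2 ℚ./ suc l ℚ.+ ρ Y (suc m)              ∎)
    where
    open ℚ.≤-Reasoning
    k : ℕ
    k = J ⊔ K
    lem : ∀ l b m → l * (b * m) + 2 * (m * m) ≡ (l * b + 2 * m) * m
    lem = solve-∀

-- Existence of the density.

n≤4^n : ∀ n → n ≤ 4 ^ n
n≤4^n zero    = z≤n
n≤4^n (suc n) = begin
  1 + n                ≤⟨ +-mono-≤ (m^n>0 4 n) (n≤4^n n) ⟩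
  4 ^ n + 4 ^ n        ≤⟨ +-monoʳ-≤ (4 ^ n) (m≤m+n (4 ^ n) _) ⟩
  4 * 4 ^ n            ∎
  where open ≤-Reasoning

module _ {X : SetOfℕ} (within : ∀ i → ∃[ l ] CountWithin X l i) where

  -- With `t = 4 ^ (2 * l)`, the interval has width 1, and the constant contributes at most 1/2 at
  -- each of `m` and `n` once they reach `2 * c`. So `t` times the difference of the relative counts
  -- is at most 2, and `2 * l ≤ t`.
  count-cauchy : ∀ l → ∃[ M ] ∀ m n → M ≤ m → M ≤ n →
                 l * (count X m * n) ≤ l * (count X n * m) + m * n
  count-cauchy l with within (2 * l)
  ... | d , c , bounds = 2 * c , half
    where
    open ≤-Reasoning
    t : ℕ
    t = 4 ^ (2 * l)
    coarse : ∀ m n → 2 * c ≤ m → 2 * c ≤ n →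
             2 * (t * (count X m * n)) ≤ 2 * (t * (count X n * m)) + 4 * (m * n)
    coarse m n 2c≤m 2c≤n = begin
      2 * (t * (count X m * n))                         ≡⟨ lem₁ t (count X m) n ⟩
      2 * (t * count X m * n)                           ≤⟨ *-monoʳ-≤ 2 (*-monoˡ-≤ n (proj₂ (bounds m))) ⟩
      2 * ((suc d * m + c) * n)                         ≡⟨ lem₂ d m c n ⟩
      2 * (d * n * m) + 2 * (m * n) + 2 * c * n
        ≤⟨ +-mono-≤ (+-monoˡ-≤ (2 * (m * n)) (*-monoʳ-≤ 2 (*-monoˡ-≤ m (proj₁ (bounds n)))))
                                                                    (*-monoˡ-≤ n 2c≤m) ⟩
      2 * ((t * count X n + c) * m) + 2 * (m * n) + m * n
                                                        ≡⟨ lem₃ t (count X n) c m n ⟩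
      2 * (t * (count X n * m)) + 3 * (m * n) + m * (2 * c)
                                                        ≤⟨ +-monoʳ-≤ _ (*-monoʳ-≤ m 2c≤n) ⟩
      2 * (t * (count X n * m)) + 3 * (m * n) + m * n   ≡⟨ lem₄ (2 * (t * (count X n * m))) (m * n) ⟩
      2 * (t * (count X n * m)) + 4 * (m * n)           ∎
      where
      lem₁ : ∀ t a n → 2 * (t * (a * n)) ≡ 2 * (t * a * n)
      lem₁ = solve-∀
      lem₂ : ∀ d m c n → 2 * (((1 + d) * m + c) * n) ≡ 2 * (d * n * m) + 2 * (m * n) + 2 * c * n
      lem₂ = solve-∀
      lem₃ : ∀ t a c m n → 2 * ((t * a + c) * m) + 2 * (m * n) + m * n ≡
                           2 * (t * (a * m)) + 3 * (m * n) + m * (2 * c)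
      lem₃ = solve-∀
      lem₄ : ∀ a b → a + 3 * b + b ≡ a + 4 * b
      lem₄ = solve-∀
    -- Since 2 * l ≤ t, the bound scales down to a factor l.
    half : ∀ m n → 2 * c ≤ m → 2 * c ≤ n → l * (count X m * n) ≤ l * (count X n * m) + m * n
    half m n 2c≤m 2c≤n with ≤-total (count X m * n) (count X n * m)
    ... | inj₁ le = ≤-trans (*-monoʳ-≤ l le) (m≤m+n _ _)
    ... | inj₂ ge = begin
      l * a                  ≡⟨ cong (l *_) (sym (m+[n∸m]≡n ge)) ⟩
      l * (b + k)            ≡⟨ *-distribˡ-+ l b k ⟩
      l * b + l * k          ≤⟨ +-monoʳ-≤ (l * b) (*-cancelˡ-≤ 4 4lk≤4mn) ⟩
      l * b + m * n          ∎
      where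
      a b k : ℕ
      a = count X m * n
      b = count X n * m
      k = a ∸ b
      4lk≤4mn : 4 * (l * k) ≤ 4 * (m * n)
      4lk≤4mn = +-cancelˡ-≤ (2 * (t * b)) _ _ $ begin
        2 * (t * b) + 4 * (l * k)      ≡⟨ cong (2 * (t * b) +_) (lem₁ l k) ⟩
        2 * (t * b) + 2 * (2 * l * k)  ≤⟨ +-monoʳ-≤ (2 * (t * b)) (*-monoʳ-≤ 2 (*-monoˡ-≤ k (n≤4^n (2 * l)))) ⟩
        2 * (t * b) + 2 * (t * k)      ≡⟨ lem₂ t b k ⟩
        2 * (t * (b + k))              ≡⟨ cong (λ z → 2 * (t * z)) (m+[n∸m]≡n ge) ⟩
        2 * (t * a)                    ≤⟨ coarse m n 2c≤m 2c≤n ⟩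
        2 * (t * b) + 4 * (m * n)      ∎
        where
        lem₁ : ∀ l k → 4 * (l * k) ≡ 2 * (2 * l * k)
        lem₁ = solve-∀
        lem₂ : ∀ t b k → 2 * (t * b) + 2 * (t * k) ≡ 2 * (t * (b + k))
        lem₂ = solve-∀

  ρ-cauchy : ∀ l → ∃[ M ] ∀ m n → M ≤ m → M ≤ n →
             ℚ.∣ ρ X (suc m) ℚ.- ρ X (suc n) ∣ ℚ.≤ ℤ.+ 1 ℚ./ suc l
  ρ-cauchy l with count-cauchy (suc l)
  ... | M , close = M , λ m n M≤m M≤n → ∣p-q∣≤r (below m n M≤m M≤n) (below n m M≤n M≤m)
    where
    below : ∀ m n → M ≤ m → M ≤ n → ρ X (suc m) ℚ.≤ ℤ.+ 1 ℚ./ suc l ℚ.+ ρ X (suc n)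
    below m n M≤m M≤n = fraction-≤ (count X (suc m)) (count X (suc n)) 1 m n l
      (≤-trans (close (suc m) (suc n) (m≤n⇒m≤1+n M≤m) (m≤n⇒m≤1+n M≤n))
               (+-monoʳ-≤ _ (≤-reflexive (sym (*-identityˡ (suc m * suc n))))))

  -- The relative counts themselves, from `m = 1` on, represent the real.
  countWithin⇒density : ∃[ r ] HasDensity X r
  countWithin⇒density = r , λ ε ε>0 → let l , l<ε = unit-fraction-< ε>0 ; M , close = ρ-cauchy l in
    suc M , λ { (suc m) (s≤s M≤m) → ℤ.+ 1 ℚ./ suc l , l<ε , M , λ k M≤k → close m k M≤m M≤k }
    where
    r : ℝ
    r = record
      { seq    = λ k → ρ X (suc k)
      ; cauchy = λ ε ε>0 → let l , l<ε = unit-fraction-< ε>0 ; M , close = ρ-cauchy l in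
          M , λ m n M≤m M≤n → ℚ.≤-<-trans (close m n M≤m M≤n) l<ε
      }

-- Diagonalisation

column-suc : ∀ e q → column (suc e) q ≡ 4 * column e q
column-suc e q = *-assoc 4 (4 ^ e) (suc (2 * q))

4*column≢odd : ∀ e q q′ → column (suc e) q ≢ column 0 q′
4*column≢odd e q q′ eq = even≢odd (2 * column e q) q′ (begin
  2 * (2 * column e q)    ≡⟨ sym (*-assoc 2 2 (column e q)) ⟩
  4 * column e q          ≡⟨ sym (column-suc e q) ⟩
  column (suc e) q        ≡⟨ eq ⟩
  1 * suc (2 * q′)        ≡⟨ *-identityˡ (suc (2 * q′)) ⟩
  suc (2 * q′)            ∎)
  where open ≡-Reasoning

column-injective : ∀ e e′ q q′ → column e q ≡ column e′ q′ → e ≡ e′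
column-injective zero    zero     q q′ eq = refl
column-injective zero    (suc e′) q q′ eq = contradiction (sym eq) (4*column≢odd e′ q′ q)
column-injective (suc e) zero     q q′ eq = contradiction eq (4*column≢odd e q q′)
column-injective (suc e) (suc e′) q q′ eq = cong suc (column-injective e e′ q q′
  (*-cancelˡ-≡ (column e q) (column e′ q′) 4
    (trans (sym (column-suc e q)) (trans eq (column-suc e′ q′)))))

-- The 2-adic valuation is even on the left and odd on the right; factors of 4 are cancelled until
-- one side shows its parity.
column≢2*column : ∀ e e′ q q′ → column e q ≢ 2 * column e′ q′
column≢2*column zero    e′ q q′ eq =
  even≢odd (column e′ q′) q (trans (sym eq) (*-identityˡ (suc (2 * q))))
column≢2*column (suc e) zero q q′ eq =
  even≢odd (column e q) q′ (trans (*-cancelˡ-≡ (2 * column e q) (column 0 q′) 2 (begin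
    2 * (2 * column e q)    ≡⟨ sym (*-assoc 2 2 (column e q)) ⟩
    4 * column e q          ≡⟨ sym (column-suc e q) ⟩
    column (suc e) q        ≡⟨ eq ⟩
    2 * column 0 q′         ∎)) (*-identityˡ (suc (2 * q′))))
  where open ≡-Reasoning
column≢2*column (suc e) (suc e′) q q′ eq = column≢2*column e e′ q q′
  (*-cancelˡ-≡ (column e q) (2 * column e′ q′) 4 (begin
    4 * column e q            ≡⟨ sym (column-suc e q) ⟩
    column (suc e) q          ≡⟨ eq ⟩
    2 * column (suc e′) q′    ≡⟨ cong (2 *_) (column-suc e′ q′) ⟩
    2 * (4 * column e′ q′)    ≡⟨ lem (column e′ q′) ⟩
    4 * (2 * column e′ q′)    ∎))
  where
  open ≡-Reasoning
  lem : ∀ y → 2 * (4 * y) ≡ 4 * (2 * y)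
  lem = solve-∀

q≤column : ∀ e q → q ≤ column e q
q≤column e q = begin
  q                      ≤⟨ m≤n⇒m≤1+n (m≤m+n q _) ⟩
  suc (2 * q)            ≡⟨ sym (*-identityˡ _) ⟩
  1 * suc (2 * q)        ≤⟨ *-monoˡ-≤ (suc (2 * q)) (m^n>0 4 e) ⟩
  column e q             ∎
  where open ≤-Reasoning

-- Bounding the changes of the approximation.

T-ext : ∀ {b c} → (T b → T c) → (T c → T b) → b ≡ c
T-ext {true}  {true}  _ _ = refl
T-ext {true}  {false} h _ = ⊥-elim (h _)
T-ext {false} {true}  _ h = ⊥-elim (h _)
T-ext {false} {false} _ _ = refl

bit-cong : ∀ e k s {p q} → peak 0 1 e k s ≡ p → peak 1 0 e k s ≡ q →
           bit e k s ≡ window (suc (p + (cap e ∸ q)))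
bit-cong e k s refl refl = refl

-- `V` serves as a counter: wherever `h` changes, it must increase by at least one.
changes-≤ : ∀ (h : ℕ → Bool) (V : ℕ → ℕ) → (∀ s → V s ≤ V (suc s)) →
            (∀ s → V s ≡ V (suc s) → h s ≡ h (suc s)) →
            ∀ m → sumTo m (λ s → χ (h s xor h (suc s))) ≤ V m
changes-≤ h V mono same zero    = z≤n
changes-≤ h V mono same (suc m) with m≤n⇒m<n∨m≡n (mono m)
... | inj₁ lt = ≤-trans (+-mono-≤ (changes-≤ h V mono same m) (χ≤1 _)) (≤-trans (≤-reflexive (+-comm (V m) 1)) lt)
... | inj₂ eq rewrite sym (same m eq) | xor-same (h m) =
  ≤-trans (≤-reflexive (+-identityʳ _)) (≤-trans (changes-≤ h V mono same m) (mono m))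

module _ (f : ℕ → ℕ) where

  active⇒column : ∀ {e x} → T (active f e x) → ∃[ q ] x ≡ column e q
  active⇒column {e} {x} h = let q , _ , hq = anyTo-elim (suc x) (λ q → x ≡ᵇ column e q) (proj₁ (∧-elim h)) in q , ≡ᵇ⇒≡ x _ hq

  -- Shows that a search below `suc x` misses no active column.
  active-≤ : ∀ {e x} → T (active f e x) → e ≤ x
  active-≤ {e} {x} h with active⇒column {e} h
  ... | q , refl = ≤-trans (n≤4^n e) (m≤m*n (4 ^ e) (suc (2 * q)))

  active-unique : ∀ {e e′ x} → T (active f e x) → T (active f e′ x) → e ≡ e′
  active-unique {e} {e′} h h′ = let q , eq = active⇒column {e} h ; q′ , eq′ = active⇒column {e′} h′ in
    column-injective e e′ q q′ (trans (sym eq) eq′)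

  approx-active : ∀ {e x} → T (active f e x) → ∀ s → approx f x (suc s) ≡ bit e x (suc s)
  approx-active {e} {x} act s = T-ext
    (λ h → let e′ , _ , h′ = anyTo-elim (suc x) (guess s) h ; act′ , hb = ∧-elim h′ in
      subst (λ e → T (bit e x (suc s))) (active-unique {e′} {e} {x} act′ act) hb)
    (λ h → anyTo-intro (suc x) (guess s) (s≤s (active-≤ {e} {x} act)) (∧-intro act h))
    where
    guess : ℕ → ℕ → Bool
    guess s e = active f e x ∧ bit e x (suc s)

  approx-inactive : ∀ {x} → (∀ e → ¬ T (active f e x)) → ∀ s → approx f x s ≡ false
  approx-inactive none zero    = refl
  approx-inactive {x} none (suc s) = T-ext
    (λ h → let e , _ , h′ = anyTo-elim (suc x) (λ e → active f e x ∧ bit e x (suc s)) h in none e (proj₁ (∧-elim h′))) ⊥-elim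

  few-if-inactive : ∀ x → (∀ e → ¬ T (active f e x)) → ∀ m → sumTo m (λ s → χ (changes (approx f) x s)) ≤ f x
  few-if-inactive x none m = ≤-trans
    (changes-≤ (approx f x) (const 0) (λ _ → z≤n) (λ s _ → trans (off s) (sym (off (suc s)))) m) z≤n
    where
    off : ∀ s → approx f x s ≡ false
    off = approx-inactive none

  few-if-active : ∀ e x → T (active f e x) → ∀ m → sumTo m (λ s → χ (changes (approx f) x s)) ≤ f x
  few-if-active e x act m = ≤-trans (changes-≤ (approx f x) V mono same m) (bound m)
    where
    V : ℕ → ℕ
    -- The jump from 0 to a successor pays for a change at the first stage, where `approx` leaves
    -- its default `false`.
    V zero    = 0
    V (suc s) = suc (peak 0 1 e x (suc s) + peak 1 0 e x (suc s))
    mono : ∀ s → V s ≤ V (suc s)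
    mono zero    = z≤n
    mono (suc s) = s≤s (+-mono-≤ (peak-mono 0 1 e x (n≤1+n (suc s))) (peak-mono 1 0 e x (n≤1+n (suc s))))
    same : ∀ s → V s ≡ V (suc s) → approx f x s ≡ approx f x (suc s)
    same (suc s) eq = begin
      approx f x (suc s)         ≡⟨ approx-active {e} {x} act s ⟩
      bit e x (suc s)            ≡⟨ bit-cong e x (suc s) eq₁ eq₂ ⟩
      bit e x (suc (suc s))      ≡⟨ sym (approx-active {e} {x} act (suc s)) ⟩
      approx f x (suc (suc s))   ∎
      where
      open ≡-Reasoning
      p p′ q q′ : ℕ
      p  = peak 0 1 e x (suc s)
      p′ = peak 0 1 e x (suc (suc s))
      q  = peak 1 0 e x (suc s)
      q′ = peak 1 0 e x (suc (suc s))
      p≤p′ : p ≤ p′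
      p≤p′ = peak-mono 0 1 e x (n≤1+n (suc s))
      q≤q′ : q ≤ q′
      q≤q′ = peak-mono 1 0 e x (n≤1+n (suc s))
      -- Neither peak decreases, so if their sum is unchanged, so is each of them.
      eq₁ : p ≡ p′
      eq₁ = ≤-antisym p≤p′ (+-cancelʳ-≤ q p′ p
        (≤-trans (+-monoʳ-≤ p′ q≤q′) (≤-reflexive (sym (suc-injective eq)))))
      eq₂ : q ≡ q′
      eq₂ = +-cancelˡ-≡ p q q′ (trans (suc-injective eq) (cong (_+ q′) (sym eq₁)))
    bound : ∀ m → V m ≤ f x
    bound zero    = z≤n
    bound (suc s) = ≤-trans
      (s≤s (+-mono-≤ (peak-≤ 0 1 e x (suc s)) (≤-trans (peak-≤ 1 0 e x (suc s)) (≤-reflexive (sym (+-identityʳ (cap e)))))))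
      (<ᵇ⇒< (2 * cap e) (f x) (proj₂ (∧-elim act)))

  approx-changes : ∀ x → AtMost (f x) (changes (approx f) x)
  approx-changes x m = subst (_≤ f x) (sym (count≡sumTo (changes (approx f) x) m))
    (few (T? (anyTo (suc x) act)))
    where
    act : ℕ → Bool
    act e = active f e x
    few : Dec (T (anyTo (suc x) act)) → sumTo m (λ s → χ (changes (approx f) x s)) ≤ f x
    few (no none)  = few-if-inactive x
      (λ e h → none (anyTo-intro (suc x) act (s≤s (active-≤ {e} {x} h)) h)) m
    few (yes some) = let e , _ , h = anyTo-elim (suc x) act some in few-if-active e x h m

-- Windows modulo 16 and sets of close density.

window-low : ∀ q {r} → r < 8 → T (window (q * 16 + r))
window-low q {r} r<8 = anyTo-intro (suc (q * 16 + r)) _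
  (s≤s (≤-trans (m≤m*n q 16) (m≤m+n (q * 16) r)))
  (∧-intro (≤⇒≤ᵇ (m≤m+n (q * 16) r)) (<⇒<ᵇ (+-monoʳ-< (q * 16) r<8)))

window-high : ∀ q {r} → 8 ≤ r → r < 16 → ¬ T (window (q * 16 + r))
window-high q {r} 8≤r r<16 h with anyTo-elim (suc (q * 16 + r)) _ h
... | j , _ , hj with ∧-elim hj
...   | ge , lt = <⇒≱ (<ᵇ⇒< _ _ lt) (+-mono-≤ (*-monoˡ-≤ 16 j≤q) 8≤r)
  where
  open ≤-Reasoning
  j≤q : j ≤ q
  j≤q = s≤s⁻¹ (*-cancelʳ-< 16 j (suc q) (begin-strict
    j * 16         ≤⟨ ≤ᵇ⇒≤ _ _ ge ⟩
    q * 16 + r     <⟨ +-monoʳ-< (q * 16) r<16 ⟩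
    q * 16 + 16    ≡⟨ +-comm (q * 16) 16 ⟩
    suc q * 16     ∎))

from-slack : ∀ {c m} → 8 * c ≤ m → 16 * c ≤ 2 * m
from-slack {c} le = ≤-trans (≤-reflexive (*-assoc 2 8 c)) (*-monoʳ-≤ 2 le)

Close : (l : ℕ) (X Y : SetOfℕ) → Set
Close l X Y = Eventually (λ m → l * count X m ≤ l * count Y m + 2 * m)

-- Here `scale e` is `4 * 4 ^ suc e`. Half of the slack `m` covers the difference of the counts,
-- which is why closeness is taken at `4 * scale e`; the other half covers the constant `c` once
-- `8 * c ≤ m`.
close-lower : ∀ e {l X Y} → CountWithin X l (suc e) → Close (4 * scale e) X Y →
              Eventually (λ m → 4 * l * m ≤ scale e * count Y m + m)
close-lower e {l} {X} {Y} (c , within) (M , close) = M ⊔ 8 * c , λ m le → *-cancelˡ-≤ 4 $ begin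
  4 * (4 * l * m)                                 ≡⟨ lem₁ l m ⟩
  16 * (l * m)                                    ≤⟨ *-monoʳ-≤ 16 (proj₁ (within m)) ⟩
  16 * (4 ^ suc e * count X m + c)                ≡⟨ lem₂ (4 ^ e) (count X m) c ⟩
  4 * scale e * count X m + 16 * c                ≤⟨ +-mono-≤ (close m (≤-trans (m≤m⊔n M _) le))
                                                              (from-slack {c} {m} (≤-trans (m≤n⊔m M _) le)) ⟩
  4 * scale e * count Y m + 2 * m + 2 * m         ≡⟨ lem₃ (scale e) (count Y m) m ⟩
  4 * (scale e * count Y m + m)                   ∎
  where
  open ≤-Reasoning
  lem₁ : ∀ d m → 4 * (4 * d * m) ≡ 16 * (d * m)
  lem₁ = solve-∀
  lem₂ : ∀ t k c → 16 * (4 * t * k + c) ≡ 4 * (t * 16) * k + 16 * c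
  lem₂ = solve-∀
  lem₃ : ∀ s k m → 4 * s * k + 2 * m + 2 * m ≡ 4 * (s * k + m)
  lem₃ = solve-∀

close-upper : ∀ e {l X Y} → CountWithin X l (suc e) → Close (4 * scale e) Y X →
              Eventually (λ m → scale e * count Y m ≤ (4 * l + 4) * m + m)
close-upper e {l} {X} {Y} (c , within) (M , close) = M ⊔ 8 * c , λ m le → *-cancelˡ-≤ 4 $ begin
  4 * (scale e * count Y m)                       ≡⟨ sym (*-assoc 4 (scale e) _) ⟩
  4 * scale e * count Y m                         ≤⟨ close m (≤-trans (m≤m⊔n M _) le) ⟩
  4 * scale e * count X m + 2 * m                 ≡⟨ lem₁ (4 ^ e) (count X m) m ⟩
  16 * (4 ^ suc e * count X m) + 2 * m            ≤⟨ +-monoˡ-≤ (2 * m) (*-monoʳ-≤ 16 (proj₂ (within m))) ⟩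
  16 * (suc l * m + c) + 2 * m                    ≡⟨ lem₂ l m c ⟩
  4 * ((4 * l + 4) * m) + 2 * m + 16 * c
    ≤⟨ +-monoʳ-≤ (4 * ((4 * l + 4) * m) + 2 * m) (from-slack {c} {m} (≤-trans (m≤n⊔m M _) le)) ⟩
  4 * ((4 * l + 4) * m) + 2 * m + 2 * m           ≡⟨ lem₃ ((4 * l + 4) * m) m ⟩
  4 * ((4 * l + 4) * m + m)                       ∎
  where
  open ≤-Reasoning
  lem₁ : ∀ t k m → 4 * (t * 16) * k + 2 * m ≡ 16 * (4 * t * k) + 2 * m
  lem₁ = solve-∀
  lem₂ : ∀ d m c → 16 * ((1 + d) * m + c) + 2 * m ≡ 4 * ((4 * d + 4) * m) + 2 * m + 16 * c
  lem₂ = solve-∀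
  lem₃ : ∀ k m → 4 * k + 2 * m + 2 * m ≡ 4 * (k + m)
  lem₃ = solve-∀

-- The set B and its density.

module Diagonal (em : ExcludedMiddle 0ℓ) (f : ℕ → ℕ)
  (f-mono : Monotonic₁ _≤_ _≤_ f) (f-unbounded : Unbounded f) where

  B-limit : ∀ x → ∃[ b ] Eventually (λ s → approx f x s ≡ b)
  B-limit x = stabilises-Bool em (approx f x) (approx-changes f x)

  B : SetOfℕ
  B x = proj₁ (B-limit x)

  B-fce : Computable f → FCE f B
  B-fce fc = approx f , approx-computable fc , λ x → refl , proj₂ (B-limit x) , approx-changes f x

  ups downs level : ℕ → ℕ
  ups e   = proj₁ (peak-limit em 0 1 e)
  downs e = proj₁ (peak-limit em 1 0 e)
  level e = suc (ups e + (cap e ∸ downs e))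

  digit : ℕ → Bool
  digit e = window (level e)

  B-column : ∀ e → Eventually (λ q → B (column e q) ≡ digit e)
  -- From `x₀` on, `f` leaves room for the changes, so the column is active; from `K₁` and `K₂` on,
  -- the peaks with `k = x` tend to `ups e` and `downs e`. The bounds pass from `q` to `x` as
  -- `q ≤ column e q`.
  B-column e = x₀ ⊔ (K₁ ⊔ K₂) , eventual
    where
    x₀ K₁ K₂ : ℕ
    x₀ = proj₁ (f-unbounded (2 * cap e))
    K₁ = proj₁ (proj₂ (peak-limit em 0 1 e))
    K₂ = proj₁ (proj₂ (peak-limit em 1 0 e))
    eventual : ∀ q → x₀ ⊔ (K₁ ⊔ K₂) ≤ q → B (column e q) ≡ digit e
    eventual q le = let S , h = Eventually-zipWith
                          (λ s b≡ (u≡ , d≡) → trans (sym b≡) ∘ agree s u≡ d≡)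
                          lim-x (Eventually-zipWith (λ _ → _,_) lim-u lim-d)
                    -- A positive stage is needed, since `approx` is `false` at stage 0 whatever the
                    -- bit.
                    in h (suc S) (n≤1+n S) z<s
      where
      x : ℕ
      x = column e q
      le-x : x₀ ⊔ (K₁ ⊔ K₂) ≤ x
      le-x = ≤-trans le (q≤column e q)
      act : T (active f e x)
      act = ∧-intro
        (anyTo-intro (suc x) (λ q → x ≡ᵇ column e q) (s≤s (q≤column e q)) (≡⇒≡ᵇ x x refl))
        (<⇒<ᵇ (<-≤-trans (proj₂ (f-unbounded (2 * cap e))) (f-mono (≤-trans (m≤m⊔n x₀ _) le-x))))
      agree : ∀ s → peak 0 1 e x s ≡ ups e → peak 1 0 e x s ≡ downs e → 0 < s → approx f x s ≡ digit e
      agree (suc s) u≡ d≡ _ = trans (approx-active f {e} {x} act s) (bit-cong e x (suc s) u≡ d≡)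
      lim-x : Eventually (λ s → approx f x s ≡ B x)
      lim-x = proj₂ (B-limit x)
      lim-u : Eventually (λ s → peak 0 1 e x s ≡ ups e)
      lim-u = proj₂ (proj₂ (peak-limit em 0 1 e)) x (≤-trans (m≤m⊔n K₁ K₂) (≤-trans (m≤n⊔m x₀ _) le-x))
      lim-d : Eventually (λ s → peak 1 0 e x s ≡ downs e)
      lim-d = proj₂ (proj₂ (peak-limit em 1 0 e)) x (≤-trans (m≤n⊔m K₁ K₂) (≤-trans (m≤n⊔m x₀ _) le-x))

  B-columnwise : Columnwise B digit
  B-columnwise = B-column , λ e q → let S , h = proj₂ (B-limit (2 * column e q)) in
    trans (sym (h S ≤-refl))
          (approx-inactive f (λ e′ act → let q′ , eq = active⇒column f {e′} {2 * column e q} act in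
            column≢2*column e′ e q′ q (sym eq)) S)

  B-within : ∀ i → CountWithin B (digits digit i) i
  B-within = columnwise⇒countWithin B-columnwise

  downs-≤-cap : ∀ e → downs e ≤ cap e
  downs-≤-cap e = let K , h = proj₂ (peak-limit em 1 0 e) ; S , hS = h K ≤-refl in
    subst (_≤ cap e) (hS S ≤-refl) (peak-≤ 1 0 e K S)

  -- The next binary digit of 4 ^ e * ρ B was chosen to disagree with level e.
  level-out-of-range : ∀ e {δ} → level e ≡ 4 * digits digit (suc e) + cap e + δ → ¬ δ < 8
  level-out-of-range e {δ} eq δ<8 = clash (digit e) refl
    where
    q : ℕ
    q = digits digit e + e * 4 ^ e
    lem : ∀ d x e t δ → 4 * (4 * d + 2 * x) + e * (t * 16) + δ ≡ (d + e * t) * 16 + (8 * x + δ)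
    lem = solve-∀
    -- The remainder modulo 16 is `δ` or `8 + δ` according to the digit, since `cap e` is a multiple
    -- of 16.
    level≡ : level e ≡ q * 16 + (8 * χ (digit e) + δ)
    level≡ = trans eq (trans (cong (λ z → 4 * z + cap e + δ) (digits-suc digit e))
                             (lem (digits digit e) (χ (digit e)) e (4 ^ e) δ))
    clash : ∀ b → digit e ≡ b → ⊥
    clash true  d = window-high q {8 + δ} (m≤m+n 8 δ) (+-monoʳ-< 8 δ<8)
      (subst (T ∘ window) (trans level≡ (cong (λ b → q * 16 + (8 * χ b + δ)) d)) (subst T (sym d) _))
    clash false d = subst T d
      (subst (T ∘ window) (sym (trans level≡ (cong (λ b → q * 16 + (8 * χ b + δ)) d))) (window-low q δ<8))

  -- The index `e` pairs a program for the approximation of `C` with `n`. If the densities agreed,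
  -- `level e` would exceed `A + cap e` by at most 6, which `level-out-of-range` excludes.
  B-diagonal : ∀ {r} → HasDensity B r → ∀ n C → NCE n C → ¬ HasDensity C r
  B-diagonal {r} B-density n C (g , (c , c-g) , hg) C-density =
    level-out-of-range e {δ} (sym (trans (+-comm _ δ) (m∸n+n≡m lower))) (s≤s δ≤7)
    where
    open ≤-Reasoning
    module Ap = Approximation {n} {C} {g} {c} c-g hg
    e A δ : ℕ
    e = Ap.e
    A = 4 * digits digit (suc e)
    δ = level e ∸ (A + cap e)
    low : A + downs e ≤ suc (ups e)
    low = Ap.peak-lower (proj₂ (peak-limit em 0 1 e)) (proj₂ (peak-limit em 1 0 e)) {A}
            (close-lower e {digits digit (suc e)} {B} {C} (B-within (suc e))
              (equal-density⇒close {B} {C} {r} B-density C-density (4 * scale e)))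
    high : ups e ≤ suc (A + 4 + downs e)
    high = Ap.peak-upper (proj₂ (peak-limit em 0 1 e)) (proj₂ (peak-limit em 1 0 e)) {A + 4}
             (close-upper e {digits digit (suc e)} {B} {C} (B-within (suc e))
               (equal-density⇒close {C} {B} {r} C-density B-density (4 * scale e)))
    level+downs : level e + downs e ≡ suc (ups e) + cap e
    level+downs = trans (+-assoc (suc (ups e)) (cap e ∸ downs e) (downs e))
                        (cong (suc (ups e) +_) (m∸n+n≡m (downs-≤-cap e)))
    lower : A + cap e ≤ level e
    lower = +-cancelʳ-≤ (downs e) (A + cap e) (level e) $ begin
      A + cap e + downs e      ≡⟨ lem A (cap e) (downs e) ⟩
      A + downs e + cap e      ≤⟨ +-monoˡ-≤ (cap e) low ⟩
      suc (ups e) + cap e      ≡⟨ sym level+downs ⟩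
      level e + downs e        ∎
      where
      lem : ∀ a b c → a + b + c ≡ a + c + b
      lem = solve-∀
    -- The 6 consists of the interval width at precision `4 ^ suc e`, which is 4 units of
    -- `1 / scale e`, the rounding error of 1 in `peak-upper`, and the `suc` in `level`.
    upper : level e ≤ A + cap e + 6
    upper = +-cancelʳ-≤ (downs e) (level e) (A + cap e + 6) $ begin
      level e + downs e                    ≡⟨ level+downs ⟩
      suc (ups e) + cap e                  ≤⟨ +-monoˡ-≤ (cap e) (s≤s high) ⟩
      2 + (A + 4 + downs e) + cap e        ≡⟨ lem A (downs e) (cap e) ⟩
      A + cap e + 6 + downs e              ∎
      where
      lem : ∀ a d c → 2 + (a + 4 + d) + c ≡ a + c + 6 + d
      lem = solve-∀
    δ≤7 : δ ≤ 7
    δ≤7 = m≤n⇒m≤1+n (m≤n+o⇒m∸n≤o (level e) (A + cap e) upper)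

corollary5p3 : ExcludedMiddle 0ℓ →
    ∀ (f : ℕ → ℕ) → Computable f → Monotonic₁ _≤_ _≤_ f → Unbounded f →
    ∃[ B ] FCE f B ×
      (∃[ r ] HasDensity B r ×
        (∀ (n : ℕ) (C : SetOfℕ) → NCE n C → ¬ HasDensity C r))
corollary5p3 em f f-computable f-mono f-unbounded =
  B , B-fce f-computable , proj₁ B-density , proj₂ B-density , B-diagonal {proj₁ B-density} (proj₂ B-density)
  where
  open Diagonal em f f-mono f-unbounded
  B-density : ∃[ r ] HasDensity B r
  B-density = countWithin⇒density (λ i → digits digit i , B-within i)
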